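{- For every $k \in \mathbb{N}$ and all real $\varepsilon, B > 0$, there exist $\gamma, T > 0$ (depending only on $k,\varepsilon,B$) such that the following holds. Let $\mathcal{H}$ be a $k$-uniform hypergraph with $N$ vertices, and suppose that $m_0 \in \mathbb{N}$ with $m_0 < N$ satisfies $$\Delta_{\mathcal{H}}(m_0) \le B\,\mu_{\mathcal{H}}(m_0)^2 / m_0 .$$ Then for every integer $m$ with $T m_0 \le m < N$ there exists a function $f_m \colon \mathcal{P}(V(\mathcal{H}))^{k-1} \rightarrow \mathcal{I}_\varepsilon(\mathcal{H})$ such that an $m$-element subset $I \subseteq V(\mathcal{H})$, chosen uniformly at random among all $m$-element subsets, with probability at least $1 - \varepsilon^m$ satisfies at least one of the following properties: (P1) $e(I) \ge \gamma \cdot \mu_{\mathcal{H}}(m)$; or (P2) there exists $F \subseteq I$ with $|F| = \lfloor \varepsilon m \rfloor$ such that for some $\mathbf{F} \in \mathcal{P}(F)^{k-1}$ we have $I \subseteq F \cup f_m(\mathbf{F})$.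
   Context: $\mathbb{N}$ denotes the positive integers. For a $k$-uniform hypergraph $\mathcal{H}$ (finite; identified with its set of hyperedges, each a $k$-element subset of the vertex set $V(\mathcal{H})$), $N = |V(\mathcal{H})|$ and $e(\mathcal{H})$ is the number of hyperedges. For $S \subseteq V(\mathcal{H})$, $e(S)$ is the number of hyperedges of $\mathcal{H}$ contained in $S$. Define $$\mu_{\mathcal{H}}(m) = e(\mathcal{H}) (m/N)^k, \qquad \Delta_{\mathcal{H}}(m) = \sum_{(e,e') \in \Lambda_{\mathcal{H}}} (m/N)^{|e \cup e'|},$$ where $\Lambda_{\mathcal{H}} = \{(e,e') \in \mathcal{H} \times \mathcal{H} : e \cap e' \neq \emptyset\}$ is the set of ordered pairs of intersecting hyperedges (including $e = e'$). For $\varepsilon > 0$, $\mathcal{I}_\varepsilon(\mathcal{H})$ is the family of all $S \subseteq V(\mathcal{H})$ with $e(S) \le \varepsilon\, e(\mathcal{H})$. For a set $F$, $\mathcal{P}(F)$ is the family of all subsets of $F$, and $\mathcal{P}(F)^{k-1}$ is the set of $(k-1)$-tuples of subsets of $F$. -}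

module Defs where

open import Algebra.Bundles.Raw using (RawSemiring)
import Algebra.Definitions.RawSemiring as Exp
open import Data.Bool.Base using (Bool; T)
open import Data.Integer.Base using (+_)
open import Data.List.Base
  using (List; [_]; _++_; map; foldr; filter; filterᵇ; length; cartesianProduct)
open import Data.List.Relation.Unary.All using (All)
open import Data.List.Relation.Unary.Unique.Propositional using (Unique)
open import Data.Nat.Base as ℕ using (ℕ; zero; suc; NonZero)
import Data.Nat.Properties as ℕ
open import Data.Product.Base using (Σ; ∃; _×_; _,_)
open import Data.Rational.Base as ℚ using (ℚ; 0ℚ; 1ℚ; ½)
import Data.Rational.Properties as ℚ
open import Data.Rational.Solver using (module +-*-Solver)
open import Data.Vec.Base as Vec using (Vec)
open import Level using (0ℓ)
open import Relation.Binary.PropositionalEquality using (_≡_; refl; sym; trans; cong; cong₂; subst)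

------------------------------------------------------------------------
-- Real numbers

Cauchy : (ℕ → ℚ) → Set
Cauchy x = ∀ δ → 0ℚ ℚ.< δ →
  ∃ λ M → ∀ i j → M ℕ.≤ i → M ℕ.≤ j → ℚ.∣ x i ℚ.- x j ∣ ℚ.< δ

record ℝ : Set where
  constructor mkℝ
  field
    seq    : ℕ → ℚ
    cauchy : Cauchy seq

open ℝ public

-- Sequences are not quotiented: x and y denote the same real number when
-- x ≤ y and y ≤ x.

infix 4 _≤_ _<_ _≈_

_≤_ : ℝ → ℝ → Set
x ≤ y = ∀ δ → 0ℚ ℚ.< δ → ∃ λ M → ∀ i → M ℕ.≤ i → seq x i ℚ.≤ seq y i ℚ.+ δ

_<_ : ℝ → ℝ → Set
x < y = ∃ λ δ → 0ℚ ℚ.< δ × ∃ λ M → ∀ i → M ℕ.≤ i → seq x i ℚ.+ δ ℚ.≤ seq y i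

_≈_ : ℝ → ℝ → Set
x ≈ y = x ≤ y × y ≤ x

private
  module _ where
    open +-*-Solver

    telescope : ∀ a b → a ≡ (a ℚ.- b) ℚ.+ b
    telescope = solve 2 (λ a b → a := (a :- b) :+ b) refl

    neg-diff : ∀ a b → ℚ.- (a ℚ.- b) ≡ ℚ.- a ℚ.- (ℚ.- b)
    neg-diff = solve 2 (λ a b → :- (a :- b) := :- a :- (:- b)) refl

    sum-diff : ∀ a b c d → (a ℚ.+ b) ℚ.- (c ℚ.+ d) ≡ (a ℚ.- c) ℚ.+ (b ℚ.- d)
    sum-diff = solve 4 (λ a b c d → (a :+ b) :- (c :+ d) := (a :- c) :+ (b :- d)) refl

    product-diff : ∀ a b c d → a ℚ.* b ℚ.- c ℚ.* d ≡ a ℚ.* (b ℚ.- d) ℚ.+ d ℚ.* (a ℚ.- c)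
    product-diff = solve 4 (λ a b c d → a :* b :- c :* d := a :* (b :- d) :+ d :* (a :- c)) refl

  half+half : ∀ δ → ½ ℚ.* δ ℚ.+ ½ ℚ.* δ ≡ δ
  half+half δ = trans (sym (ℚ.*-distribʳ-+ δ ½ ½)) (ℚ.*-identityˡ δ)

  half-pos : ∀ {δ} → 0ℚ ℚ.< δ → 0ℚ ℚ.< ½ ℚ.* δ
  half-pos {δ} 0<δ = ℚ.positive⁻¹ (½ ℚ.* δ) {{ℚ.pos*pos⇒pos ½ δ {{ℚ.positive 0<δ}}}}

  const-cauchy : ∀ q → Cauchy (λ _ → q)
  const-cauchy q δ 0<δ = 0 , λ _ _ _ _ →
    subst (ℚ._< δ) (sym (cong ℚ.∣_∣ (ℚ.+-inverseʳ q))) 0<δ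

  +-cauchy : ∀ x y → Cauchy x → Cauchy y → Cauchy (λ i → x i ℚ.+ y i)
  +-cauchy x y cx cy δ 0<δ with cx (½ ℚ.* δ) (half-pos 0<δ) | cy (½ ℚ.* δ) (half-pos 0<δ)
  ... | M , hx | M′ , hy = M ℕ.⊔ M′ , λ i j p q → begin-strict
    ℚ.∣ (x i ℚ.+ y i) ℚ.- (x j ℚ.+ y j) ∣
      ≡⟨ cong ℚ.∣_∣ (sum-diff (x i) (y i) (x j) (y j)) ⟩
    ℚ.∣ (x i ℚ.- x j) ℚ.+ (y i ℚ.- y j) ∣
      ≤⟨ ℚ.∣p+q∣≤∣p∣+∣q∣ (x i ℚ.- x j) (y i ℚ.- y j) ⟩
    ℚ.∣ x i ℚ.- x j ∣ ℚ.+ ℚ.∣ y i ℚ.- y j ∣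
      <⟨ ℚ.+-mono-< (hx i j (ℕ.m⊔n≤o⇒m≤o M M′ p) (ℕ.m⊔n≤o⇒m≤o M M′ q))
                    (hy i j (ℕ.m⊔n≤o⇒n≤o M M′ p) (ℕ.m⊔n≤o⇒n≤o M M′ q)) ⟩
    ½ ℚ.* δ ℚ.+ ½ ℚ.* δ
      ≡⟨ half+half δ ⟩
    δ ∎
    where
    open ℚ.≤-Reasoning

  neg-cauchy : ∀ x → Cauchy x → Cauchy (λ i → ℚ.- x i)
  neg-cauchy x cx δ 0<δ with cx δ 0<δ
  ... | M , h = M , λ i j p q → subst (ℚ._< δ) (eq i j) (h i j p q)
    where
    eq : ∀ i j → ℚ.∣ x i ℚ.- x j ∣ ≡ ℚ.∣ ℚ.- x i ℚ.- ℚ.- x j ∣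
    eq i j = trans (sym (ℚ.∣-p∣≡∣p∣ (x i ℚ.- x j)))
      (cong ℚ.∣_∣ (neg-diff (x i) (x j)))

  bounded : ∀ x → Cauchy x → ∃ λ M → ∃ λ K → 0ℚ ℚ.< K × (∀ i → M ℕ.≤ i → ℚ.∣ x i ∣ ℚ.≤ K)
  bounded x cx with cx 1ℚ (ℚ.positive⁻¹ 1ℚ)
  ... | M , h = M , 1ℚ ℚ.+ ℚ.∣ x M ∣ , ℚ.+-mono-<-≤ (ℚ.positive⁻¹ 1ℚ) (ℚ.0≤∣p∣ (x M)) , λ i p → begin
    ℚ.∣ x i ∣
      ≡⟨ cong ℚ.∣_∣ (telescope (x i) (x M)) ⟩
    ℚ.∣ (x i ℚ.- x M) ℚ.+ x M ∣
      ≤⟨ ℚ.∣p+q∣≤∣p∣+∣q∣ (x i ℚ.- x M) (x M) ⟩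
    ℚ.∣ x i ℚ.- x M ∣ ℚ.+ ℚ.∣ x M ∣
      ≤⟨ ℚ.+-monoˡ-≤ ℚ.∣ x M ∣ (ℚ.<⇒≤ (h i M p ℕ.≤-refl)) ⟩
    1ℚ ℚ.+ ℚ.∣ x M ∣ ∎
    where
    open ℚ.≤-Reasoning

  scale : ∀ K → 0ℚ ℚ.< K → ∀ δ → 0ℚ ℚ.< δ → ∃ λ δ′ → 0ℚ ℚ.< δ′ × K ℚ.* δ′ ≡ δ
  scale K 0<K δ 0<δ = K⁻¹ ℚ.* δ ,
    ℚ.positive⁻¹ (K⁻¹ ℚ.* δ) {{ℚ.pos*pos⇒pos K⁻¹ {{ℚ.1/pos⇒pos K}} δ {{ℚ.positive 0<δ}}}} ,
    trans (sym (ℚ.*-assoc K K⁻¹ δ)) (trans (cong (ℚ._* δ) (ℚ.*-inverseʳ K)) (ℚ.*-identityˡ δ))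
    where
    instance
      K-pos : ℚ.Positive K
      K-pos = ℚ.positive 0<K
      K-nonZero : ℚ.NonZero K
      K-nonZero = ℚ.pos⇒nonZero K
    K⁻¹ = ℚ.1/ K

  product-bound : ∀ a b c d K L δ₁ δ₂ → 0ℚ ℚ.< K → 0ℚ ℚ.< L →
    ℚ.∣ a ∣ ℚ.≤ K → ℚ.∣ d ∣ ℚ.≤ L → ℚ.∣ b ℚ.- d ∣ ℚ.< δ₁ → ℚ.∣ a ℚ.- c ∣ ℚ.< δ₂ →
    ℚ.∣ a ℚ.* b ℚ.- c ℚ.* d ∣ ℚ.< K ℚ.* δ₁ ℚ.+ L ℚ.* δ₂
  product-bound a b c d K L δ₁ δ₂ 0<K 0<L a≤K d≤L b-d<δ₁ a-c<δ₂ = begin-strict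
    ℚ.∣ a ℚ.* b ℚ.- c ℚ.* d ∣
      ≡⟨ cong ℚ.∣_∣ (product-diff a b c d) ⟩
    ℚ.∣ a ℚ.* (b ℚ.- d) ℚ.+ d ℚ.* (a ℚ.- c) ∣
      ≤⟨ ℚ.∣p+q∣≤∣p∣+∣q∣ (a ℚ.* (b ℚ.- d)) (d ℚ.* (a ℚ.- c)) ⟩
    ℚ.∣ a ℚ.* (b ℚ.- d) ∣ ℚ.+ ℚ.∣ d ℚ.* (a ℚ.- c) ∣
      <⟨ ℚ.+-mono-< (step a (b ℚ.- d) K δ₁ 0<K a≤K b-d<δ₁) (step d (a ℚ.- c) L δ₂ 0<L d≤L a-c<δ₂) ⟩
    K ℚ.* δ₁ ℚ.+ L ℚ.* δ₂ ∎
    where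
    open ℚ.≤-Reasoning
    step : ∀ p q K δ → 0ℚ ℚ.< K → ℚ.∣ p ∣ ℚ.≤ K → ℚ.∣ q ∣ ℚ.< δ → ℚ.∣ p ℚ.* q ∣ ℚ.< K ℚ.* δ
    step p q K δ 0<K p≤K q<δ = subst (ℚ._< K ℚ.* δ) (sym (ℚ.∣p*q∣≡∣p∣*∣q∣ p q))
      (ℚ.≤-<-trans (ℚ.*-monoʳ-≤-nonNeg ℚ.∣ q ∣ {{ℚ.∣-∣-nonNeg q}} p≤K)
                   (ℚ.*-monoʳ-<-pos K {{ℚ.positive 0<K}} q<δ))

  *-cauchy : ∀ x y → Cauchy x → Cauchy y → Cauchy (λ i → x i ℚ.* y i)
  *-cauchy x y cx cy δ 0<δ =
    let Bx , K , 0<K , hK = bounded x cx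
        By , L , 0<L , hL = bounded y cy
        δ₁ , 0<δ₁ , Kδ₁ = scale K 0<K (½ ℚ.* δ) (half-pos 0<δ)
        δ₂ , 0<δ₂ , Lδ₂ = scale L 0<L (½ ℚ.* δ) (half-pos 0<δ)
        My , hy = cy δ₁ 0<δ₁
        Mx , hx = cx δ₂ 0<δ₂
        B = Bx ℕ.⊔ By
        M = Mx ℕ.⊔ My
    in B ℕ.⊔ M , λ i j p q →
      subst (ℚ.∣ x i ℚ.* y i ℚ.- x j ℚ.* y j ∣ ℚ.<_)
        (trans (cong₂ ℚ._+_ Kδ₁ Lδ₂) (half+half δ))
        (product-bound (x i) (y i) (x j) (y j) K L δ₁ δ₂ 0<K 0<L
          (hK i (ℕ.m⊔n≤o⇒m≤o Bx By (ℕ.m⊔n≤o⇒m≤o B M p)))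
          (hL j (ℕ.m⊔n≤o⇒n≤o Bx By (ℕ.m⊔n≤o⇒m≤o B M q)))
          (hy i j (ℕ.m⊔n≤o⇒n≤o Mx My (ℕ.m⊔n≤o⇒n≤o B M p)) (ℕ.m⊔n≤o⇒n≤o Mx My (ℕ.m⊔n≤o⇒n≤o B M q)))
          (hx i j (ℕ.m⊔n≤o⇒m≤o Mx My (ℕ.m⊔n≤o⇒n≤o B M p)) (ℕ.m⊔n≤o⇒m≤o Mx My (ℕ.m⊔n≤o⇒n≤o B M q))))

infixl 6 _+_ _-_
infixl 7 _*_
infix  8 -_

fromℚ : ℚ → ℝ
fromℚ q = mkℝ (λ _ → q) (const-cauchy q)

fromℕ : ℕ → ℝ
fromℕ n = fromℚ (+ n ℚ./ 1)

0ℝ 1ℝ : ℝ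
0ℝ = fromℚ 0ℚ
1ℝ = fromℚ 1ℚ

_+_ : ℝ → ℝ → ℝ
x + y = mkℝ (λ i → seq x i ℚ.+ seq y i) (+-cauchy (seq x) (seq y) (cauchy x) (cauchy y))

-_ : ℝ → ℝ
- x = mkℝ (λ i → ℚ.- seq x i) (neg-cauchy (seq x) (cauchy x))

_-_ : ℝ → ℝ → ℝ
x - y = x + - y

_*_ : ℝ → ℝ → ℝ
x * y = mkℝ (λ i → seq x i ℚ.* seq y i) (*-cauchy (seq x) (seq y) (cauchy x) (cauchy y))

ℝ-rawSemiring : RawSemiring 0ℓ 0ℓ
ℝ-rawSemiring = record
  { Carrier = ℝ ; _≈_ = _≈_ ; _+_ = _+_ ; _*_ = _*_ ; 0# = 0ℝ ; 1# = 1ℝ }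

open Exp ℝ-rawSemiring public using (_^_)
open Exp ℚ.+-*-rawSemiring public using () renaming (_^_ to _^ℚ_)

-- The floor of a real number cannot be computed constructively, so it is
-- given by its defining property rather than as a function.
IsFloor : ℝ → ℕ → Set
IsFloor x n = fromℕ n ≤ x × x < fromℕ (suc n)

------------------------------------------------------------------------
-- Hypergraphs

open import Data.Fin.Subset using (Subset; inside; outside; ∣_∣; _∩_; _∪_)
open import Data.Fin.Subset.Properties using (_⊆?_; nonempty?)

-- k-uniform hypergraphs with vertex set Fin N.
record Hypergraph (k N : ℕ) : Set where
  field
    edges    : List (Subset N)
    distinct : Unique edges
    uniform  : All (λ e → ∣ e ∣ ≡ k) edges

open Hypergraph public

module _ {k N : ℕ} (H : Hypergraph k N) where

  #edges : ℕ
  #edges = length (edges H)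

  #edgesIn : Subset N → ℕ
  #edgesIn S = length (filter (_⊆? S) (edges H))

  Λ : List (Subset N × Subset N)
  Λ = filter (λ (e , e′) → nonempty? (e ∩ e′)) (cartesianProduct (edges H) (edges H))

  μ : .{{NonZero N}} → ℕ → ℚ
  μ m = (+ #edges ℚ./ 1) ℚ.* (+ m ℚ./ N) ^ℚ k

  Δ : .{{NonZero N}} → ℕ → ℚ
  Δ m = foldr ℚ._+_ 0ℚ (map (λ (e , e′) → (+ m ℚ./ N) ^ℚ ∣ e ∪ e′ ∣) Λ)

  𝓘 : ℝ → Set
  𝓘 ε = ∃ λ S → fromℕ (#edgesIn S) ≤ ε * fromℕ #edges

------------------------------------------------------------------------
-- Uniformly random m-element subsets

subsets : ∀ N → List (Subset N)
subsets zero    = [ Vec.[] ]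
subsets (suc N) = map (inside Vec.∷_) (subsets N) ++ map (outside Vec.∷_) (subsets N)

subsetsOfSize : ∀ N → ℕ → List (Subset N)
subsetsOfSize N m = filter (λ I → ∣ I ∣ ℕ.≟ m) (subsets N)

-- "A uniformly random m-element I ⊆ Fin N has property P with probability at
-- least p", for m ≤ N. Since P need not be decidable (it may involve real
-- inequalities), the favourable outcomes are given as a decidable subevent G
-- of P; the inequality |G| / |Ω| ≥ p is multiplied out by |Ω|.
WithProbabilityAtLeast : ℝ → ∀ {N} → ℕ → (Subset N → Set) → Set
WithProbabilityAtLeast p {N} m P =
  Σ (Subset N → Bool) λ G →
    (∀ I → ∣ I ∣ ≡ m → T (G I) → P I) ×
    p * fromℕ (length (subsetsOfSize N m)) ≤ fromℕ (length (filterᵇ G (subsetsOfSize N m)))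

{-# OPTIONS --safe #-}
-- Every m-element I satisfies (P1) or (P2), so no randomness is needed: a container algorithm
-- works for all sets that span few edges.
--
-- Let n be a small constant fraction of m and r ≈ N / n.  The hypothesis bounds the sum of
-- r ^ |g ∩ h| over intersecting pairs of edges, so by Markov most edges are light (their own share
-- of the sum is at most a constant times the average).  Given a set X, repeatedly pick the first
-- v ∈ X that has degree at least e / (8 n r) among the available edges, move the link of v to a
-- (k-1)-uniform multihypergraph G, and discard the edges containing v and those meeting G too
-- heavily; few edges are ever discarded.  If the process stops within n steps, then X avoids the
-- dense vertices; otherwise G satisfies the same kind of hypothesis with a new constant, and one
-- recurses on G.  At uniformity 1, X meets the set D of dense vertices in few points unless X spans
-- many edges.  In all cases D has size at least cN.  Removing D and repeating boundedly many times
-- leaves a set S with e(S) ≤ ε e(H).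
--
-- Every query to X is answered by a vertex that is recorded as a pick, so running the algorithm on
-- the set of picks instead of X returns the same S.  Hence one set of at most εm picks, together
-- with the few exceptional points of X outside S, is a fingerprint.
module Submission where

module Containers where

  open import Data.Bool.Base using (Bool; true; false; if_then_else_)
  open import Data.Empty using (⊥-elim)
  open import Data.Fin.Base using (Fin; zero; suc)
  open import Data.Fin.Properties using () renaming (_≟_ to _≟ᶠ_)
  open import Data.Fin.Subset
    using (Subset; inside; ⁅_⁆; _⊆_; _∪_; _∩_; _─_; _-_; ∣_∣; _∈_; _∉_; Empty; ⊤)
  open import Data.Fin.Subset using () renaming (⊥ to ∅)
  open import Data.Fin.Subset.Properties
  open import Data.List.Base
    using (List; []; _∷_; _++_; map; filter; length; allFin; find)
  open import Data.List.Membership.Propositional using () renaming (_∈_ to _∈ˡ_)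
  open import Data.List.Membership.Propositional.Properties
    using (∈-filter⁻; ∈-map⁻; ∈-allFin)
  open import Data.List.Properties
    using (map-∘; map-++; map-cong; map-tabulate; length-tabulate; length-++; length-map)
  open import Data.List.Relation.Unary.Any using (here; there)
  open import Data.List.Relation.Unary.All using ([]; _∷_) renaming (All to Allˡ)
  open import Data.List.Relation.Unary.All using () renaming
      (all? to allˡ?; lookup to lookupˡ; tabulate to tabulateˡ; map to mapˡ)
  open import Data.List.Relation.Unary.All.Properties using (all-filter; filter⁺; ++⁺; ++⁻ˡ; ++⁻ʳ)
  open import Data.Maybe.Base using (Maybe; just; nothing)
  open import Data.Nat.Base hiding (∣_-_∣)
  open import Data.Nat.ListAction using (sum)
  open import Data.Nat.ListAction.Properties using (sum-++)
  open import Data.Nat.Properties hiding (_≟_)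
  open import Data.Nat.Tactic.RingSolver using (solve-∀)
  open import Data.Product.Base using (∃; ∃₂; _×_; _,_; proj₁; proj₂)
  open import Data.Sum.Base using (inj₁; inj₂)
  open import Data.Vec.Base as Vec using (Vec; []; _∷_; tabulate)
  open import Data.Vec.Relation.Unary.All using (All; []; _∷_)
  open import Data.Vec.Base using () renaming (here to hereᵛ; there to thereᵛ)
  open import Data.Vec.Properties using (lookup∘tabulate; []=⇒lookup; lookup⇒[]=)
  open import Function.Base using (_∘_; id)
  open import Relation.Binary.PropositionalEquality using (_≡_; refl; sym; trans; cong; cong₂; subst)
  open import Relation.Nullary using (Dec; yes; no; does; ¬_; contradiction; ¬?; _×-dec_)
  open import Relation.Unary using (Pred; Decidable)
  open import Level using (0ℓ)

  open import Data.Nat.DivMod using (_/_; _%_; m/n*n≤m; m≡m%n+[m/n]*n; m%n<n; m*n/n≡m; /-monoˡ-≤)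

  open ≤-Reasoning

  -- Finite sums and counting

  ∑ : {A : Set} → List A → (A → ℕ) → ℕ
  ∑ xs f = sum (map f xs)

  𝟙 : {P : Set} → Dec P → ℕ
  𝟙 P? = if does P? then 1 else 0

  module _ {P : Set} where

    𝟙-yes : (P? : Dec P) → P → 𝟙 P? ≡ 1
    𝟙-yes (yes _) _ = refl
    𝟙-yes (no ¬p) p = contradiction p ¬p

    𝟙*-≤ : (P? : Dec P) {m n : ℕ} → (P → m ≤ n) → 𝟙 P? * m ≤ n
    𝟙*-≤ (yes p) {m} m≤n = ≤-trans (≤-reflexive (*-identityˡ m)) (m≤n p)
    𝟙*-≤ (no _)      m≤n = z≤n

    𝟙-≤ : (P? : Dec P) {n : ℕ} → (P → 1 ≤ n) → 𝟙 P? ≤ n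
    𝟙-≤ (yes p) 1≤n = 1≤n p
    𝟙-≤ (no _)  1≤n = z≤n

  𝟙-cover-× : {P Q : Set} (P? : Dec P) (Q? : Dec Q) (m : ℕ) →
              1 ≤ 𝟙 P? + m → 1 ≤ 𝟙 (P? ×-dec Q?) + (m + 𝟙 (¬? Q?))
  𝟙-cover-× P?      Q?@(no _) m 1≤ = ≤-trans (m≤n+m 1 m) (m≤n+m (m + 1) (𝟙 (P? ×-dec Q?)))
  𝟙-cover-× (yes _) (yes _) m 1≤ = s≤s z≤n
  𝟙-cover-× (no _)  (yes _) m 1≤ = ≤-trans 1≤ (m≤m+n m 0)

  -- Serves `within-edge`: `A` and `A′` are availability before and after a pick, `V` says that the
  -- edge contains the picked vertex, `S` and `X` that it lies inside the given set after and before
  -- deleting that vertex. Since `A′` excludes `V`, the two terms on the left never both count.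
  𝟙-disjoint : {A A′ V S X : Set} (A? : Dec A) (A′? : Dec A′) (V? : Dec V) (S? : Dec S) (X? : Dec X) →
               (V → S → X) → (A′ → A) → (A′ → ¬ V) →
               𝟙 A? * (𝟙 V? * 𝟙 S?) + 𝟙 A′? * 𝟙 X? ≤ 𝟙 A? * 𝟙 X?
  𝟙-disjoint (no _)  (no _)   _       _       _       _   _    _    = z≤n
  𝟙-disjoint (no ¬a) (yes a′) _       _       _       _   A′⇒A _    = contradiction (A′⇒A a′) ¬a
  𝟙-disjoint (yes _) (yes a′) (yes v) _       _       _   _    A′⇒¬V = contradiction v (A′⇒¬V a′)
  𝟙-disjoint (yes _) (yes _)  (no _)  _       _       _   _    _    = ≤-refl
  𝟙-disjoint (yes _) (no _)   (no _)  _       _       _   _    _    = z≤n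
  𝟙-disjoint (yes _) (no _)   (yes _) (no _)  _       _   _    _    = z≤n
  𝟙-disjoint (yes _) (no _)   (yes v) (yes s) (yes _) _   _    _    = ≤-refl
  𝟙-disjoint (yes _) (no _)   (yes v) (yes s) (no ¬x) VS⇒X _    _    = contradiction (VS⇒X v s) ¬x

  module _ {A : Set} where

    ∑-mono : ∀ {f g : A → ℕ} xs → (∀ {x} → x ∈ˡ xs → f x ≤ g x) → ∑ xs f ≤ ∑ xs g
    ∑-mono []       f≤g = z≤n
    ∑-mono (x ∷ xs) f≤g = +-mono-≤ (f≤g (here refl)) (∑-mono xs (f≤g ∘ there))

    ∑-cong : ∀ {f g : A → ℕ} xs → (∀ x → f x ≡ g x) → ∑ xs f ≡ ∑ xs g
    ∑-cong xs f≡g = cong sum (map-cong f≡g xs)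

    ∑-++ : ∀ (f : A → ℕ) xs ys → ∑ (xs ++ ys) f ≡ ∑ xs f + ∑ ys f
    ∑-++ f xs ys = trans (cong sum (map-++ f xs ys)) (sum-++ (map f xs) (map f ys))

    ∑-distrib-+ : ∀ (f g : A → ℕ) xs → ∑ xs (λ x → f x + g x) ≡ ∑ xs f + ∑ xs g
    ∑-distrib-+ f g []       = refl
    ∑-distrib-+ f g (x ∷ xs) = trans (cong (f x + g x +_) (∑-distrib-+ f g xs))
      (interchange (f x) (g x) (∑ xs f) (∑ xs g))
      where
      interchange : ∀ a b c d → a + b + (c + d) ≡ a + c + (b + d)
      interchange = solve-∀

    ∑-distribˡ-* : ∀ c (f : A → ℕ) xs → ∑ xs (λ x → c * f x) ≡ c * ∑ xs f
    ∑-distribˡ-* c f []       = sym (*-zeroʳ c)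
    ∑-distribˡ-* c f (x ∷ xs) = trans (cong (c * f x +_) (∑-distribˡ-* c f xs))
      (sym (*-distribˡ-+ c (f x) (∑ xs f)))

    ∑-const : ∀ c (xs : List A) → ∑ xs (λ _ → c) ≡ length xs * c
    ∑-const c []       = refl
    ∑-const c (x ∷ xs) = cong (c +_) (∑-const c xs)

    ∑-zero : (xs : List A) → ∑ xs (λ _ → 0) ≡ 0
    ∑-zero xs = trans (∑-const 0 xs) (*-zeroʳ (length xs))

    ∑-map : {B : Set} (f : B → ℕ) (h : A → B) (xs : List A) → ∑ (map h xs) f ≡ ∑ xs (f ∘ h)
    ∑-map f h xs = cong sum (sym (map-∘ xs))

    module _ {P : Pred A 0ℓ} (P? : Decidable P) where

      ∑-filter : ∀ f xs → ∑ (filter P? xs) f ≡ ∑ xs (λ x → 𝟙 (P? x) * f x)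
      ∑-filter f []       = refl
      ∑-filter f (x ∷ xs) with does (P? x)
      ... | true  = cong₂ _+_ (sym (*-identityˡ (f x))) (∑-filter f xs)
      ... | false = ∑-filter f xs

      length-filter-∑ : ∀ xs → length (filter P? xs) ≡ ∑ xs (𝟙 ∘ P?)
      length-filter-∑ []       = refl
      length-filter-∑ (x ∷ xs) with does (P? x)
      ... | true  = cong suc (length-filter-∑ xs)
      ... | false = length-filter-∑ xs

      ∑-filter-≤ : ∀ f xs → ∑ (filter P? xs) f ≤ ∑ xs f
      ∑-filter-≤ f xs = ≤-trans (≤-reflexive (∑-filter f xs))
        (∑-mono xs (λ {x} _ → 𝟙*-≤ (P? x) (λ _ → ≤-refl)))

      length-partition : ∀ xs →
        length xs ≡ length (filter P? xs) + length (filter (¬? ∘ P?) xs)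
      length-partition []       = refl
      length-partition (x ∷ xs) with does (P? x)
      ... | true  = cong suc (length-partition xs)
      ... | false = trans (cong suc (length-partition xs))
        (sym (+-suc (length (filter P? xs)) (length (filter (¬? ∘ P?) xs))))

      markov : ∀ {c} {f : A → ℕ} xs → (∀ {x} → P x → c ≤ f x) →
               c * length (filter P? xs) ≤ ∑ xs f
      markov {c} {f} xs c≤f = begin
        c * length (filter P? xs)        ≡⟨ *-comm c _ ⟩
        length (filter P? xs) * c        ≡⟨ ∑-const c (filter P? xs) ⟨
        ∑ (filter P? xs) (λ _ → c)
          ≤⟨ ∑-mono (filter P? xs) (λ x∈ → c≤f (proj₂ (∈-filter⁻ P? {xs = xs} x∈))) ⟩
        ∑ (filter P? xs) f               ≤⟨ ∑-filter-≤ f xs ⟩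
        ∑ xs f                           ∎
        where open ≤-Reasoning

      find-just : ∀ {x} xs → find P? xs ≡ just x → P x
      find-just (y ∷ xs) eq with P? y
      find-just (y ∷ xs) refl | yes py = py
      find-just (y ∷ xs) eq   | no _   = find-just xs eq

      find-nothing : ∀ {x} xs → find P? xs ≡ nothing → x ∈ˡ xs → ¬ P x
      find-nothing (y ∷ xs) eq x∈ with P? y
      find-nothing (y ∷ xs) () x∈           | yes _
      find-nothing (y ∷ xs) eq (here refl)  | no ¬py = ¬py
      find-nothing (y ∷ xs) eq (there x∈xs) | no _   = find-nothing xs eq x∈xs

    module _ {P Q : Pred A 0ℓ} (P? : Decidable P) (Q? : Decidable Q) where

      find-restrict-nothing : ∀ xs → (∀ {x} → Q x → P x) → find P? xs ≡ nothing → find Q? xs ≡ nothing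
      find-restrict-nothing []       Q⇒P eq = refl
      find-restrict-nothing (y ∷ xs) Q⇒P eq with P? y | Q? y
      find-restrict-nothing (y ∷ xs) Q⇒P () | yes _  | _
      ... | no ¬py | yes qy = contradiction (Q⇒P qy) ¬py
      ... | no _   | no _   = find-restrict-nothing xs Q⇒P eq

      -- Candidates ahead of the hit fail `P?` and hence `Q?`, so the hit stays first. This is what
      -- allows a run to be replayed on its own picks.
      find-restrict-just : ∀ {x} xs → (∀ {x} → Q x → P x) → Q x → find P? xs ≡ just x → find Q? xs ≡ just x
      find-restrict-just (y ∷ xs) Q⇒P qx eq with P? y | Q? y
      find-restrict-just (y ∷ xs) Q⇒P qx refl | yes _ | yes _  = refl
      find-restrict-just (y ∷ xs) Q⇒P qx refl | yes _ | no ¬qy = contradiction qx ¬qy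
      ... | no ¬py | yes qy = contradiction (Q⇒P qy) ¬py
      ... | no _   | no _   = find-restrict-just xs Q⇒P qx eq

  ∑-swap : {A B : Set} (f : A → B → ℕ) (xs : List A) (ys : List B) →
           ∑ xs (λ x → ∑ ys (f x)) ≡ ∑ ys (λ y → ∑ xs (λ x → f x y))
  ∑-swap f []       ys = sym (∑-zero ys)
  ∑-swap f (x ∷ xs) ys = trans (cong (∑ ys (f x) +_) (∑-swap f xs ys))
    (sym (∑-distrib-+ (f x) (λ y → ∑ xs (λ x → f x y)) ys))

  𝟙-cover-all : {A : Set} {P : Pred A 0ℓ} (P? : Decidable P) (xs : List A) →
                1 ≤ 𝟙 (allˡ? (λ x → ¬? (P? x)) xs) + ∑ xs (𝟙 ∘ P?)
  𝟙-cover-all P? xs with allˡ? (λ x → ¬? (P? x)) xs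
  ... | yes _   = s≤s z≤n
  ... | no ¬all with find P? xs in eq
  ...   | nothing = contradiction (tabulateˡ (find-nothing P? xs eq)) ¬all
  ...   | just x  = some xs eq
    where
    some : ∀ {x} xs → find P? xs ≡ just x → 1 ≤ ∑ xs (𝟙 ∘ P?)
    some (y ∷ ys) eq with does (P? y)
    ... | true  = s≤s z≤n
    ... | false = some ys eq

  -- Subsets of `Fin N` and their cardinalities.

  module _ {N : ℕ} where

    ⟦_⟧ : {P : Pred (Fin N) 0ℓ} → Decidable P → Subset N
    ⟦ P? ⟧ = tabulate (does ∘ P?)

    ∈⟦⟧⁺ : {P : Pred (Fin N) 0ℓ} (P? : Decidable P) → ∀ {v} → P v → v ∈ ⟦ P? ⟧
    ∈⟦⟧⁺ P? {v} p with P? v in eq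
    ... | yes _ = lookup⇒[]= v ⟦ P? ⟧ (trans (lookup∘tabulate (does ∘ P?) v) (cong does eq))
    ... | no ¬p = contradiction p ¬p

    ∈⟦⟧⁻ : {P : Pred (Fin N) 0ℓ} (P? : Decidable P) → ∀ {v} → v ∈ ⟦ P? ⟧ → P v
    ∈⟦⟧⁻ P? {v} v∈ with P? v in eq
    ... | yes p = p
    ... | no _ with trans (sym (cong does eq)) (trans (sym (lookup∘tabulate (does ∘ P?) v)) ([]=⇒lookup v∈))
    ...   | ()

    fromList : List (Fin N) → Subset N
    fromList []       = ∅
    fromList (v ∷ vs) = ⁅ v ⁆ ∪ fromList vs

    ∈-fromList : ∀ {v vs} → v ∈ˡ vs → v ∈ fromList vs
    ∈-fromList {vs = u ∷ vs} (here refl) = p⊆p∪q (fromList vs) (x∈⁅x⁆ u)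
    ∈-fromList {vs = u ∷ vs} (there v∈)  = q⊆p∪q ⁅ u ⁆ (fromList vs) (∈-fromList v∈)

    fromList-⊆ : ∀ {X vs} → Allˡ (_∈ X) vs → fromList vs ⊆ X
    fromList-⊆ []                       v∈ = ⊥-elim (∉⊥ v∈)
    fromList-⊆ {X} {u ∷ vs} (u∈X ∷ vs⊆X) v∈ with x∈p∪q⁻ ⁅ u ⁆ (fromList vs) v∈
    ... | inj₁ v∈⁅u⁆ = subst (_∈ X) (sym (x∈⁅y⁆⇒x≡y u v∈⁅u⁆)) u∈X
    ... | inj₂ v∈vs  = fromList-⊆ vs⊆X v∈vs

  allFin-suc : ∀ N → allFin (suc N) ≡ zero ∷ map suc (allFin N)
  allFin-suc N = cong (zero ∷_) (sym (map-tabulate id suc))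

  ∣p∣≡∑ : ∀ {N} (p : Subset N) → ∣ p ∣ ≡ ∑ (allFin N) (λ v → 𝟙 (v ∈? p))
  ∣p∣≡∑ []      = refl
  ∣p∣≡∑ {suc N} (s ∷ p) = trans (head-tail s)
      (sym (trans (cong (λ vs → ∑ vs (λ v → 𝟙 (v ∈? (s ∷ p)))) (allFin-suc N))
      (cong (𝟙 (zero ∈? (s ∷ p)) +_) (trans (∑-map (λ v → 𝟙 (v ∈? (s ∷ p))) suc (allFin N))
          (∑-cong (allFin N) (drop s))))))
    where
    drop : ∀ s v → 𝟙 (suc v ∈? (s ∷ p)) ≡ 𝟙 (v ∈? p)
    drop s v with v ∈? p
    ... | yes _ = refl
    ... | no _  = refl
    head-tail : ∀ s → ∣ s ∷ p ∣ ≡ 𝟙 (zero ∈? (s ∷ p)) + ∑ (allFin N) (λ v → 𝟙 (v ∈? p))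
    head-tail true  = cong suc (∣p∣≡∑ p)
    head-tail false = ∣p∣≡∑ p

  ∣p∪q∣+∣p∩q∣ : ∀ {N} (p q : Subset N) → ∣ p ∪ q ∣ + ∣ p ∩ q ∣ ≡ ∣ p ∣ + ∣ q ∣
  ∣p∪q∣+∣p∩q∣ []          []          = refl
  ∣p∪q∣+∣p∩q∣ (true  ∷ p) (true  ∷ q) = cong suc (trans (+-suc ∣ p ∪ q ∣ ∣ p ∩ q ∣)
    (trans (cong suc (∣p∪q∣+∣p∩q∣ p q)) (sym (+-suc ∣ p ∣ ∣ q ∣))))
  ∣p∪q∣+∣p∩q∣ (true  ∷ p) (false ∷ q) = cong suc (∣p∪q∣+∣p∩q∣ p q)
  ∣p∪q∣+∣p∩q∣ (false ∷ p) (true  ∷ q) = trans (cong suc (∣p∪q∣+∣p∩q∣ p q)) (sym (+-suc ∣ p ∣ ∣ q ∣))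
  ∣p∪q∣+∣p∩q∣ (false ∷ p) (false ∷ q) = ∣p∪q∣+∣p∩q∣ p q

  ∣p∪q∣≤∣p∣+∣q∣ : ∀ {N} (p q : Subset N) → ∣ p ∪ q ∣ ≤ ∣ p ∣ + ∣ q ∣
  ∣p∪q∣≤∣p∣+∣q∣ p q = ≤-trans (m≤m+n ∣ p ∪ q ∣ ∣ p ∩ q ∣) (≤-reflexive (∣p∪q∣+∣p∩q∣ p q))

  ∣p∩q∣+∣p─q∣ : ∀ {N} (p q : Subset N) → ∣ p ∩ q ∣ + ∣ p ─ q ∣ ≡ ∣ p ∣
  ∣p∩q∣+∣p─q∣ []          []          = refl
  ∣p∩q∣+∣p─q∣ (true  ∷ p) (true  ∷ q) = cong suc (∣p∩q∣+∣p─q∣ p q)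
  ∣p∩q∣+∣p─q∣ (true  ∷ p) (false ∷ q) = trans (+-suc ∣ p ∩ q ∣ ∣ p ─ q ∣) (cong suc (∣p∩q∣+∣p─q∣ p q))
  ∣p∩q∣+∣p─q∣ (false ∷ p) (true  ∷ q) = ∣p∩q∣+∣p─q∣ p q
  ∣p∩q∣+∣p─q∣ (false ∷ p) (false ∷ q) = ∣p∩q∣+∣p─q∣ p q

  ∣fromList∣≤ : ∀ {N} (vs : List (Fin N)) → ∣ fromList vs ∣ ≤ length vs
  ∣fromList∣≤ {N} []       = ≤-reflexive (∣⊥∣≡0 N)
  ∣fromList∣≤ (v ∷ vs) = ≤-trans (∣p∪q∣≤∣p∣+∣q∣ ⁅ v ⁆ (fromList vs))
    (+-mono-≤ (≤-reflexive (∣⁅x⁆∣≡1 v)) (∣fromList∣≤ vs))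

  suc∣p-x∣≡∣p∣ : ∀ {N} (p : Subset N) {x} → x ∈ p → suc ∣ p - x ∣ ≡ ∣ p ∣
  suc∣p-x∣≡∣p∣ (_ ∷ p)     {zero}  hereᵛ      = cong (suc ∘ ∣_∣) (p─⊥≡p p)
  suc∣p-x∣≡∣p∣ (true ∷ p)  {suc x} (thereᵛ x∈p) = cong suc (suc∣p-x∣≡∣p∣ p x∈p)
  suc∣p-x∣≡∣p∣ (false ∷ p) {suc x} (thereᵛ x∈p) = suc∣p-x∣≡∣p∣ p x∈p

  x∉p-x : ∀ {N} (p : Subset N) x → x ∉ p - x
  x∉p-x (s ∷ p) (suc x) (thereᵛ x∈) = x∉p-x p x x∈

  -- Used to pad a fingerprint to the prescribed cardinality without leaving the random set.
  ⊆-between : ∀ {N} (p q : Subset N) s → p ⊆ q → ∣ p ∣ ≤ s → s ≤ ∣ q ∣ →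
              ∃ λ F → p ⊆ F × F ⊆ q × ∣ F ∣ ≡ s
  ⊆-between []          []          s       p⊆q lo hi = [] , id , id , sym (n≤0⇒n≡0 hi)
  ⊆-between (true ∷ p)  (false ∷ q) s       p⊆q lo hi with p⊆q hereᵛ
  ... | ()
  ⊆-between (true ∷ p)  (true ∷ q)  (suc s) p⊆q (s≤s lo) (s≤s hi) =
    let F , p⊆F , F⊆q , eq = ⊆-between p q s (drop-∷-⊆ p⊆q) lo hi
    in true ∷ F , s⊆s p⊆F , s⊆s F⊆q , cong suc eq
  ⊆-between (false ∷ p) (false ∷ q) s       p⊆q lo hi =
    let F , p⊆F , F⊆q , eq = ⊆-between p q s (drop-∷-⊆ p⊆q) lo hi
    in false ∷ F , s⊆s p⊆F , s⊆s F⊆q , eq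
  ⊆-between (false ∷ p) (true ∷ q)  s       p⊆q lo hi with s ≤? ∣ q ∣
  ... | yes s≤∣q∣ =
    let F , p⊆F , F⊆q , eq = ⊆-between p q s (drop-∷-⊆ p⊆q) lo s≤∣q∣
    in false ∷ F , s⊆s p⊆F , out⊆ F⊆q , eq
  -- Here `s` exceeds the size of the tail, so only the whole of `true ∷ q` is large enough.
  ... | no s≰∣q∣ = true ∷ q , p⊆q , id , ≤-antisym (≰⇒> s≰∣q∣) hi

  x∈p─q⇒x∉q : ∀ {N} (p q : Subset N) {x} → x ∈ p ─ q → x ∉ q
  x∈p─q⇒x∉q (_ ∷ p) (_ ∷ q) (thereᵛ x∈) (thereᵛ x∈q) = x∈p─q⇒x∉q p q x∈ x∈q

  -- Degrees and weighted intersections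

  cancelˡ : ∀ o {m n} → 0 < o → o * m ≤ o * n → m ≤ n
  cancelˡ o 0<o = *-cancelˡ-≤ o {{>-nonZero 0<o}}

  0<* : ∀ {m n} → 0 < m → 0 < n → 0 < m * n
  0<* = *-mono-<

  0<*⁻ʳ : ∀ m {n} → 0 < m * n → 0 < n
  0<*⁻ʳ m {zero}  0<m*0 = contradiction (≤-trans 0<m*0 (≤-reflexive (*-zeroʳ m))) n≮0
  0<*⁻ʳ m {suc n} _     = z<s

  ^-distribʳ-* : ∀ i m n → (m * n) ^ i ≡ m ^ i * n ^ i
  ^-distribʳ-* zero    m n = refl
  ^-distribʳ-* (suc i) m n = trans (cong (m * n *_) (^-distribʳ-* i m n)) (interchange m n (m ^ i) (n ^ i))
    where
    interchange : ∀ a b c d → a * b * (c * d) ≡ a * c * (b * d)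
    interchange = solve-∀

  module _ {N : ℕ} where

    -- A list of sets is read as a multihypergraph: repeated edges count with multiplicity.
    deg : List (Subset N) → Fin N → ℕ
    deg H v = length (filter (v ∈?_) H)

    #within : List (Subset N) → Subset N → ℕ
    #within H X = length (filter (_⊆? X) H)

    link : Fin N → List (Subset N) → List (Subset N)
    link v H = map (_- v) (filter (v ∈?_) H)

    deg-filter-≤ : ∀ {P : Pred (Subset N) 0ℓ} (P? : Decidable P) H v → deg (filter P? H) v ≤ deg H v
    deg-filter-≤ P? H v = begin
      deg (filter P? H) v                   ≡⟨ length-filter-∑ (v ∈?_) (filter P? H) ⟩
      ∑ (filter P? H) (λ h → 𝟙 (v ∈? h))    ≤⟨ ∑-filter-≤ P? _ H ⟩
      ∑ H (λ h → 𝟙 (v ∈? h))                ≡⟨ length-filter-∑ (v ∈?_) H ⟨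
      deg H v                               ∎

    #within-filter-≤ : ∀ {P : Pred (Subset N) 0ℓ} (P? : Decidable P) H X →
                       #within (filter P? H) X ≤ #within H X
    #within-filter-≤ P? H X = begin
      #within (filter P? H) X               ≡⟨ length-filter-∑ (_⊆? X) (filter P? H) ⟩
      ∑ (filter P? H) (λ h → 𝟙 (h ⊆? X))    ≤⟨ ∑-filter-≤ P? _ H ⟩
      ∑ H (λ h → 𝟙 (h ⊆? X))                ≡⟨ length-filter-∑ (_⊆? X) H ⟨
      #within H X                           ∎

    ∑-deg : ∀ H → ∑ (allFin N) (deg H) ≡ ∑ H ∣_∣
    ∑-deg H = begin-equality
      ∑ (allFin N) (deg H)                            ≡⟨ ∑-cong (allFin N) (λ v → length-filter-∑ (v ∈?_) H) ⟩
      ∑ (allFin N) (λ v → ∑ H (λ h → 𝟙 (v ∈? h)))     ≡⟨ ∑-swap (λ v h → 𝟙 (v ∈? h)) (allFin N) H ⟩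
      ∑ H (λ h → ∑ (allFin N) (λ v → 𝟙 (v ∈? h)))     ≡⟨ ∑-cong H (λ h → sym (∣p∣≡∑ h)) ⟩
      ∑ H ∣_∣                                         ∎

    -- For singleton edges, the vertices of X carry exactly the edges inside X.
    singleton-⊆ : ∀ {h X : Subset N} {v} → ∣ h ∣ ≡ 1 → v ∈ h → v ∈ X → h ⊆ X
    singleton-⊆ {h} {X} {v} ∣h∣≡1 v∈h v∈X {u} u∈h with u ≟ᶠ v
    ... | yes refl = v∈X
    ... | no u≢v   = contradiction
      (x∈p⇒∣p-x∣<∣p∣ (x∈p∧x≢y⇒x∈p-y u∈h u≢v))
      (λ lt → n≮0 (≤-trans lt (≤-reflexive (suc-injective (trans (suc∣p-x∣≡∣p∣ h v∈h) ∣h∣≡1)))))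

    ∑-deg-singletons : ∀ H X → Allˡ (λ h → ∣ h ∣ ≡ 1) H →
                       ∑ (allFin N) (λ v → 𝟙 (v ∈? X) * deg H v) ≤ #within H X
    ∑-deg-singletons H X sizes = begin
      ∑ (allFin N) (λ v → 𝟙 (v ∈? X) * deg H v)
        ≡⟨ ∑-cong (allFin N) (λ v → trans (cong (𝟙 (v ∈? X) *_) (length-filter-∑ (v ∈?_) H))
             (sym (∑-distribˡ-* (𝟙 (v ∈? X)) (λ h → 𝟙 (v ∈? h)) H))) ⟩
      ∑ (allFin N) (λ v → ∑ H (λ h → 𝟙 (v ∈? X) * 𝟙 (v ∈? h)))
        ≡⟨ ∑-swap (λ v h → 𝟙 (v ∈? X) * 𝟙 (v ∈? h)) (allFin N) H ⟩
      ∑ H (λ h → ∑ (allFin N) (λ v → 𝟙 (v ∈? X) * 𝟙 (v ∈? h)))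
        ≤⟨ ∑-mono H (λ h∈ → edge (lookupˡ sizes h∈)) ⟩
      ∑ H (λ h → 𝟙 (h ⊆? X))
        ≡⟨ length-filter-∑ (_⊆? X) H ⟨
      #within H X ∎
      where
      edge : ∀ {h} → ∣ h ∣ ≡ 1 → ∑ (allFin N) (λ v → 𝟙 (v ∈? X) * 𝟙 (v ∈? h)) ≤ 𝟙 (h ⊆? X)
      edge {h} ∣h∣≡1 with h ⊆? X
      ... | yes _ = begin
        ∑ (allFin N) (λ v → 𝟙 (v ∈? X) * 𝟙 (v ∈? h))
          ≤⟨ ∑-mono (allFin N) (λ {v} _ → 𝟙*-≤ (v ∈? X) (λ _ → ≤-refl)) ⟩
        ∑ (allFin N) (λ v → 𝟙 (v ∈? h))               ≡⟨ ∣p∣≡∑ h ⟨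
        ∣ h ∣                                         ≡⟨ ∣h∣≡1 ⟩
        1                                             ∎
      ... | no h⊈X = begin
        ∑ (allFin N) (λ v → 𝟙 (v ∈? X) * 𝟙 (v ∈? h))
          ≤⟨ ∑-mono (allFin N) (λ {v} _ → 𝟙*-≤ (v ∈? X)
            (λ v∈X → 𝟙-≤ (v ∈? h) (λ v∈h → ⊥-elim (h⊈X (singleton-⊆ ∣h∣≡1 v∈h v∈X))))) ⟩
        ∑ (allFin N) (λ _ → 0)  ≡⟨ ∑-zero (allFin N) ⟩
        0                       ∎

  module _ (r : ℕ) where

    -- The case zero restricts sums of weights to intersecting pairs.
    weight : ℕ → ℕ
    weight zero    = 0
    weight (suc i) = r ^ suc i

    module _ (0<r : 0 < r) where

      private
        1≤r^ : ∀ i → 1 ≤ r ^ i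
        1≤r^ i = m^n>0 r {{>-nonZero 0<r}} i

      weight-suc : ∀ i → r * weight i ≤ weight (suc i)
      weight-suc zero    = ≤-trans (≤-reflexive (*-zeroʳ r)) z≤n
      weight-suc (suc i) = ≤-refl

      weight-mono : ∀ {i j} → i ≤ j → weight i ≤ weight j
      weight-mono {zero}  _               = z≤n
      weight-mono {suc i} {suc j} (s≤s i≤j) = *-monoʳ-≤ r (^-monoʳ-≤ r {{>-nonZero 0<r}} i≤j)

      r≤weight : ∀ {i} → 1 ≤ i → r ≤ weight i
      r≤weight {suc i} _ = ≤-trans (≤-reflexive (sym (*-identityʳ r))) (*-monoʳ-≤ r (1≤r^ i))

    module _ {N : ℕ} where

      W : Subset N → Subset N → ℕ
      W g h = weight ∣ g ∩ h ∣

      load : List (Subset N) → Subset N → ℕ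
      load H g = ∑ H (W g)

      -- For `k`-uniform edges `∣ g ∪ h ∣ = 2k - ∣ g ∩ h ∣`, so at `r = N / n` this is the quantity
      -- Δ at `n`, multiplied by `r ^ (2k)`. The inequality `n * pairSum r H ≤ B * (length H *
      -- length H)` is thus the hypothesis of the theorem at `n`, cleared of denominators.
      pairSum : List (Subset N) → ℕ
      pairSum H = ∑ H (load H)

      W-sym : ∀ g h → W g h ≡ W h g
      W-sym g h = cong (weight ∘ ∣_∣) (∩-comm g h)

      load-swap : ∀ G H → ∑ H (load G) ≡ ∑ G (load H)
      load-swap G H = trans (∑-swap W H G) (∑-cong G (λ g → ∑-cong H (λ h → W-sym h g)))

      load-filter-≤ : ∀ {P : Pred (Subset N) 0ℓ} (P? : Decidable P) H g → load (filter P? H) g ≤ load H g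
      load-filter-≤ P? H g = ∑-filter-≤ P? (W g) H

      pairSum-filter-≤ : ∀ {P : Pred (Subset N) 0ℓ} (P? : Decidable P) H → pairSum (filter P? H) ≤ pairSum H
      pairSum-filter-≤ P? H = ≤-trans (∑-mono (filter P? H) (λ {g} _ → load-filter-≤ P? H g))
        (∑-filter-≤ P? (load H) H)

      pairSum-++ : ∀ L G → pairSum (L ++ G) ≡ (∑ L (load L) + 2 * ∑ L (load G)) + pairSum G
      pairSum-++ L G = begin-equality
        ∑ (L ++ G) (load (L ++ G))
          ≡⟨ ∑-cong (L ++ G) (λ g → ∑-++ (W g) L G) ⟩
        ∑ (L ++ G) (λ g → load L g + load G g)
          ≡⟨ ∑-++ _ L G ⟩
        ∑ L (λ g → load L g + load G g) + ∑ G (λ g → load L g + load G g)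
          ≡⟨ cong₂ _+_ (∑-distrib-+ (load L) (load G) L) (∑-distrib-+ (load L) (load G) G) ⟩
        (∑ L (load L) + ∑ L (load G)) + (∑ G (load L) + ∑ G (load G))
          ≡⟨ cong (λ x → (∑ L (load L) + ∑ L (load G)) + (x + ∑ G (load G))) (load-swap L G) ⟩
        (∑ L (load L) + ∑ L (load G)) + (∑ L (load G) + ∑ G (load G))
          ≡⟨ rearrange (∑ L (load L)) (∑ L (load G)) (∑ G (load G)) ⟩
        (∑ L (load L) + 2 * ∑ L (load G)) + pairSum G ∎
        where
        rearrange : ∀ a b c → (a + b) + (b + c) ≡ (a + 2 * b) + c
        rearrange = solve-∀

      module _ (0<r : 0 < r) where

        W-mono : ∀ {g g′ h h′} → g ⊆ g′ → h ⊆ h′ → W g h ≤ W g′ h′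
        W-mono {g} {g′} {h} {h′} g⊆g′ h⊆h′ = weight-mono 0<r (p⊆q⇒∣p∣≤∣q∣ λ x∈ →
          let x∈g , x∈h = x∈p∩q⁻ g h x∈ in x∈p∩q⁺ (g⊆g′ x∈g , h⊆h′ x∈h))

        load-mono : ∀ H {g h} → g ⊆ h → load H g ≤ load H h
        load-mono H g⊆h = ∑-mono H (λ {x} _ → W-mono {h = x} g⊆h id)

        -- The vertex `v` lies in `g ∩ h` but not in the intersection after deletion, so the
        -- exponent drops by at least one. This gain of a factor `r` bounds the loads inside a link.
        W-link : ∀ {v g h} → v ∈ g → v ∈ h → r * W (g - v) (h - v) ≤ W g h
        W-link {v} {g} {h} v∈g v∈h = ≤-trans (weight-suc 0<r ∣ (g - v) ∩ (h - v) ∣)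
          (weight-mono 0<r (p⊂q⇒∣p∣<∣q∣ (sub , v , x∈p∩q⁺ (v∈g , v∈h) ,
            λ v∈ → x∉p-x g v (proj₁ (x∈p∩q⁻ (g - v) (h - v) v∈)))))
          where
          sub : (g - v) ∩ (h - v) ⊆ g ∩ h
          sub x∈ = let x∈g , x∈h = x∈p∩q⁻ (g - v) (h - v) x∈ in
            x∈p∩q⁺ (p─q⊆p g ⁅ v ⁆ x∈g , p─q⊆p h ⁅ v ⁆ x∈h)

        W-meet : ∀ {v g h} → v ∈ g → v ∈ h → r ≤ W g h
        W-meet {v} {g} {h} v∈g v∈h = r≤weight 0<r (begin
          1            ≡⟨ ∣⁅x⁆∣≡1 v ⟨
          ∣ ⁅ v ⁆ ∣    ≤⟨ p⊆q⇒∣p∣≤∣q∣ (λ x∈ → subst (_∈ g ∩ h) (sym (x∈⁅y⁆⇒x≡y v x∈)) (x∈p∩q⁺ (v∈g , v∈h))) ⟩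
          ∣ g ∩ h ∣    ∎)

  -- One round, lowering the uniformity by one; n is the number of steps and r ≈ N / n.
  module Round (n r : ℕ) (0<n : 0 < n) (0<r : 0 < r) {N : ℕ} where

    light? : (K : ℕ) (H : List (Subset N)) → Decidable (λ h → n * load r H h ≤ K * length H)
    light? K H h = n * load r H h ≤? K * length H

    -- The average of `n * load r H h` over the edges is at most `B * length H`; by Markov at most a
    -- quarter of the edges exceed four times that.
    light-count : ∀ B H → 0 < B → 0 < length H → n * pairSum r H ≤ B * (length H * length H) →
                  3 * length H ≤ 4 * length (filter (light? (4 * B) H) H)
    light-count B H 0<B 0<e Δ≤ = +-cancelʳ-≤ e (3 * e) (4 * l) (begin
      3 * e + e        ≡⟨ four e ⟩
      4 * e            ≡⟨ cong (4 *_) (length-partition light H) ⟩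
      4 * (l + heavy)  ≡⟨ *-distribˡ-+ 4 l heavy ⟩
      4 * l + 4 * heavy ≤⟨ +-monoʳ-≤ (4 * l) heavy≤ ⟩
      4 * l + e        ∎)
      where
      light = light? (4 * B) H
      e = length H
      l = length (filter light H)
      heavy = length (filter (¬? ∘ light) H)
      four : ∀ e → 3 * e + e ≡ 4 * e
      four = solve-∀
      reorder : ∀ B e x → B * e * (4 * x) ≡ 4 * B * e * x
      reorder = solve-∀
      heavy≤ : 4 * heavy ≤ e
      heavy≤ = cancelˡ (B * e) (0<* 0<B 0<e) (begin
        B * e * (4 * heavy)              ≡⟨ reorder B e heavy ⟩
        4 * B * e * heavy                ≤⟨ markov (¬? ∘ light) H (<⇒≤ ∘ ≰⇒>) ⟩
        ∑ H (λ h → n * load r H h)       ≡⟨ ∑-distribˡ-* n (load r H) H ⟩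
        n * pairSum r H                  ≤⟨ Δ≤ ⟩
        B * (e * e)                      ≡⟨ *-assoc B e e ⟨
        B * e * e                        ∎)

    -- If some edge `h` passes through `v`, then every edge through `v` meets `h` and adds at least
    -- `r` to the load of `h`, which is bounded.
    deg-bound : ∀ C (H : List (Subset N)) → Allˡ (λ h → n * load r H h ≤ C) H → ∀ v → n * r * deg H v ≤ C
    deg-bound C H light v with filter (v ∈?_) H in eq
    ... | []    = ≤-trans (≤-reflexive (*-zeroʳ (n * r))) z≤n
    ... | h ∷ hs = begin
      n * r * length (h ∷ hs)                      ≡⟨ *-assoc n r _ ⟩
      n * (r * length (h ∷ hs))                    ≡⟨ cong (λ xs → n * (r * length xs)) eq ⟨
      n * (r * deg H v)                            ≤⟨ *-monoʳ-≤ n (markov (v ∈?_) H (W-meet r 0<r v∈h)) ⟩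
      n * load r H h                               ≤⟨ lookupˡ light h∈H ⟩
      C                                            ∎
      where
      h∈ : h ∈ˡ H × v ∈ h
      h∈ = ∈-filter⁻ (v ∈?_) {xs = H} (subst (h ∈ˡ_) (sym eq) (here refl))
      h∈H = proj₁ h∈
      v∈h = proj₂ h∈

    dense? : (e : ℕ) (A : List (Subset N)) → Decidable (λ v → e ≤ 8 * (n * r) * deg A v)
    dense? e A v = e ≤? 8 * (n * r) * deg A v

    dense : ℕ → List (Subset N) → Subset N
    dense e A = ⟦ dense? e A ⟧

    -- Double counting of degrees: their sum is at least `length A`, hence at least `e / 2`. The
    -- vertices outside `D` have degree below `e / (8 n r)` and, as `N ≤ 2 n r`, contribute at most
    -- `e / 4`. The other `e / 4` comes from `D`, where each degree is at most `K e / (n r)`.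
    dense-large : ∀ K e A → 0 < e → N ≤ 2 * (n * r) → Allˡ (λ h → 1 ≤ ∣ h ∣) A → e ≤ 2 * length A →
                  (∀ v → n * r * deg A v ≤ K * e) → n * r ≤ 4 * K * ∣ dense e A ∣
    dense-large K e A 0<e N≤ nonempty e≤ deg≤ = cancelˡ (2 * e) (0<* {2} z<s 0<e)
      (+-cancelʳ-≤ (2 * M * e) _ _ (begin
        2 * e * M + 2 * M * e                   ≡⟨ eq₁ M e ⟩
        4 * M * e                               ≤⟨ *-monoʳ-≤ (4 * M) e≤ ⟩
        4 * M * (2 * length A)                  ≡⟨ eq₂ M (length A) ⟩
        8 * M * (length A * 1)                  ≡⟨ cong (8 * M *_) (∑-const 1 A) ⟨
        8 * M * ∑ A (λ _ → 1)                   ≤⟨ *-monoʳ-≤ (8 * M) (∑-mono A (lookupˡ nonempty)) ⟩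
        8 * M * ∑ A ∣_∣                         ≡⟨ cong (8 * M *_) (∑-deg A) ⟨
        8 * M * ∑ (allFin N) (deg A)            ≡⟨ ∑-distribˡ-* (8 * M) (deg A) (allFin N) ⟨
        ∑ (allFin N) (λ v → 8 * M * deg A v)    ≤⟨ ∑-mono (allFin N) (λ {v} _ → pointwise v) ⟩
        ∑ (allFin N) (λ v → 8 * K * e * 𝟙 (v ∈? D) + e)
          ≡⟨ ∑-distrib-+ (λ v → 8 * K * e * 𝟙 (v ∈? D)) (λ _ → e) (allFin N) ⟩
        ∑ (allFin N) (λ v → 8 * K * e * 𝟙 (v ∈? D)) + ∑ (allFin N) (λ _ → e)
          ≡⟨ cong₂ _+_ (trans (∑-distribˡ-* (8 * K * e) (λ v → 𝟙 (v ∈? D)) (allFin N))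
            (cong (8 * K * e *_) (sym (∣p∣≡∑ D))))
               (trans (∑-const e (allFin N)) (cong (_* e) (length-tabulate {n = N} id))) ⟩
        8 * K * e * ∣ D ∣ + N * e               ≤⟨ +-monoʳ-≤ (8 * K * e * ∣ D ∣) (*-monoˡ-≤ e N≤) ⟩
        8 * K * e * ∣ D ∣ + 2 * M * e           ≡⟨ cong (_+ 2 * M * e) (eq₃ K e ∣ D ∣) ⟩
        2 * e * (4 * K * ∣ D ∣) + 2 * M * e     ∎))
      where
      M = n * r
      D = dense e A
      eq₁ : ∀ M e → 2 * e * M + 2 * M * e ≡ 4 * M * e
      eq₁ = solve-∀
      eq₂ : ∀ M a → 4 * M * (2 * a) ≡ 8 * M * (a * 1)
      eq₂ = solve-∀
      eq₃ : ∀ K e d → 8 * K * e * d ≡ 2 * e * (4 * K * d)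
      eq₃ = solve-∀
      eq₄ : ∀ K e → 8 * (K * e) ≡ 8 * K * e * 1
      eq₄ = solve-∀
      pointwise : ∀ v → 8 * M * deg A v ≤ 8 * K * e * 𝟙 (v ∈? D) + e
      pointwise v with v ∈? D
      ... | yes _ = begin
        8 * M * deg A v          ≡⟨ *-assoc 8 M (deg A v) ⟩
        8 * (M * deg A v)        ≤⟨ *-monoʳ-≤ 8 (deg≤ v) ⟩
        8 * (K * e)              ≡⟨ eq₄ K e ⟩
        8 * K * e * 1            ≤⟨ m≤m+n _ e ⟩
        8 * K * e * 1 + e        ∎
      ... | no v∉D = ≤-trans (<⇒≤ (≰⇒> (v∉D ∘ ∈⟦⟧⁺ (dense? e A)))) (m≤n+m e (8 * K * e * 0))

    module _ (K e : ℕ) (H : List (Subset N)) where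

      -- The sum of `r * n * load r G h` over all edges stays at most `K * K * e * e` during the
      -- first `n` picks. The threshold is chosen so that by Markov at most `e / 8` edges are lost
      -- to it.
      Available : List (Fin N) → List (Subset N) → Pred (Subset N) 0ℓ
      Available P G h = Allˡ (_∉ h) P × r * n * load r G h ≤ 8 * K * K * e

      available? : ∀ P G → Decidable (Available P G)
      available? P G h = allˡ? (λ v → ¬? (v ∈? h)) P ×-dec (r * n * load r G h ≤? 8 * K * K * e)

      available : List (Fin N) → List (Subset N) → List (Subset N)
      available P G = filter (available? P G) H

      pick? : ∀ X P G → Decidable (λ v → v ∈ X × e ≤ 8 * (n * r) * deg (available P G) v)
      pick? X P G v = v ∈? X ×-dec dense? e (available P G) v

      -- `upper` and `lower` fix the size of `G` up to constants at `length P * e / (n r)`. `pairs`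
      -- bounds the average load in `G` and, combined with `lower` after `n` picks, becomes the
      -- hypothesis for the next round. `inside-H` lets loads of edges of `G` in `H` be bounded by
      -- those of light edges. `within` keeps the edges of `G` inside `X` from being charged twice
      -- to `H`.
      record State (k : ℕ) (X : Subset N) (P : List (Fin N)) (G : List (Subset N)) : Set where
        field
          picked  : Allˡ (_∈ X) P
          sizes   : Allˡ (λ g → ∣ g ∣ ≡ k) G
          inside-H : Allˡ (λ g → ∃ λ h → h ∈ˡ H × g ⊆ h) G
          upper   : n * r * length G ≤ length P * (K * e)
          lower   : length P * e ≤ 8 * (n * r) * length G
          pairs   : r * n * pairSum r G ≤ length G * ((16 * K + 1) * (K * e))
          within  : #within G X + #within (available P G) X ≤ #within H X

      module _ {k : ℕ} (sizes-H : Allˡ (λ h → ∣ h ∣ ≡ suc k) H)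
               (light : Allˡ (λ h → n * load r H h ≤ K * e) H) where

        open State

        initial : ∀ X → State k X [] []
        initial X = record
          { picked = [] ; sizes = [] ; inside-H = []
          ; upper = ≤-reflexive (*-zeroʳ (n * r))
          ; lower = z≤n
          ; pairs = ≤-reflexive (*-zeroʳ (r * n))
          ; within = #within-filter-≤ (available? [] []) H X
          }

        module _ {X : Subset N} {P : List (Fin N)} {G : List (Subset N)} (S : State k X P G)
                 {v : Fin N} (v∈X : v ∈ X) (v-dense : e ≤ 8 * (n * r) * deg (available P G) v) where

          private
            A A′ L : List (Subset N)
            A  = available P G
            L  = link v A
            A′ = available (v ∷ P) (L ++ G)
            length-L : length L ≡ deg A v
            length-L = length-map (_- v) (filter (v ∈?_) A)
            length-LG : length (L ++ G) ≡ length L + length G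
            length-LG = length-++ L

          ∈-link⁻ : ∀ {l} → l ∈ˡ L → ∃ λ h → h ∈ˡ H × Available P G h × v ∈ h × l ≡ h - v
          ∈-link⁻ l∈ with ∈-map⁻ (_- v) l∈
          ... | h , h∈ , l≡ with ∈-filter⁻ (v ∈?_) {xs = A} h∈
          ... | h∈A , v∈h with ∈-filter⁻ (available? P G) {xs = H} h∈A
          ... | h∈H , av = h , h∈H , av , v∈h , l≡

          private
            load-G : ∀ {l} → l ∈ˡ L → r * n * load r G l ≤ 8 * K * K * e
            load-G l∈ with ∈-link⁻ l∈
            ... | h , _ , (_ , load≤) , _ , refl =
              ≤-trans (*-monoʳ-≤ (r * n) (load-mono r 0<r G (p─q⊆p h ⁅ v ⁆))) load≤

            load-L : ∀ {l} → l ∈ˡ L → r * n * load r L l ≤ K * e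
            load-L l∈ with ∈-link⁻ l∈
            ... | h , h∈H , _ , v∈h , refl = begin
              r * n * load r L (h - v)
                ≡⟨ cong (_* load r L (h - v)) (*-comm r n) ⟩
              n * r * load r L (h - v)
                ≡⟨ *-assoc n r _ ⟩
              n * (r * load r L (h - v))
                ≡⟨ cong (λ x → n * (r * x)) (∑-map (W r (h - v)) (_- v) (filter (v ∈?_) A)) ⟩
              n * (r * ∑ (filter (v ∈?_) A) (λ h′ → W r (h - v) (h′ - v)))
                ≡⟨ cong (n *_) (∑-distribˡ-* r _ (filter (v ∈?_) A)) ⟨
              n * ∑ (filter (v ∈?_) A) (λ h′ → r * W r (h - v) (h′ - v))
                ≤⟨ *-monoʳ-≤ n (∑-mono (filter (v ∈?_) A) (λ h′∈ →
                     W-link r 0<r v∈h (proj₂ (∈-filter⁻ (v ∈?_) {xs = A} h′∈)))) ⟩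
              n * ∑ (filter (v ∈?_) A) (W r h)
                ≤⟨ *-monoʳ-≤ n (≤-trans (∑-filter-≤ (v ∈?_) (W r h) A) (∑-filter-≤ (available? P G) (W r h) H))
                  ⟩
              n * load r H h
                ≤⟨ lookupˡ light h∈H ⟩
              K * e ∎

            -- Each new edge has scaled load at most `K * e` in the link, because it comes from a
            -- light edge, and at most `8 * K * K * e` in `G`, because it was available. The cross
            -- terms occur twice, so a new edge contributes at most
            -- `K e + 16 K K e = (16 K + 1) (K e)`.
            pairs′ : r * n * pairSum r (L ++ G) ≤ length (L ++ G) * ((16 * K + 1) * (K * e))
            pairs′ = begin
              r * n * pairSum r (L ++ G)
                ≡⟨ cong (r * n *_) (pairSum-++ r L G) ⟩
              r * n * ((∑ L (load r L) + 2 * ∑ L (load r G)) + pairSum r G)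
                ≡⟨ eq₁ (r * n) (∑ L (load r L)) (∑ L (load r G)) (pairSum r G) ⟩
              (r * n * ∑ L (load r L) + 2 * (r * n * ∑ L (load r G))) + r * n * pairSum r G
                ≤⟨ +-mono-≤ (+-mono-≤ (uniform (load r L) load-L) (*-monoʳ-≤ 2 (uniform (load r G) load-G)))
                  (pairs S) ⟩
              (length L * (K * e) + 2 * (length L * (8 * K * K * e))) + length G * ((16 * K + 1) * (K * e))
                ≡⟨ eq₂ (length L) (length G) K e ⟩
              (length L + length G) * ((16 * K + 1) * (K * e))
                ≡⟨ cong (_* ((16 * K + 1) * (K * e))) length-LG ⟨
              length (L ++ G) * ((16 * K + 1) * (K * e)) ∎
              where
              eq₁ : ∀ c a b d → c * ((a + 2 * b) + d) ≡ (c * a + 2 * (c * b)) + c * d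
              eq₁ = solve-∀
              eq₂ : ∀ l g K e → (l * (K * e) + 2 * (l * (8 * K * K * e))) + g * ((16 * K + 1) * (K * e))
                                ≡ (l + g) * ((16 * K + 1) * (K * e))
              eq₂ = solve-∀
              uniform : ∀ (f : Subset N → ℕ) {c} → (∀ {l} → l ∈ˡ L → r * n * f l ≤ c) →
                        r * n * ∑ L f ≤ length L * c
              uniform f {c} f≤c = begin
                r * n * ∑ L f              ≡⟨ ∑-distribˡ-* (r * n) f L ⟨
                ∑ L (λ l → r * n * f l)    ≤⟨ ∑-mono L f≤c ⟩
                ∑ L (λ _ → c)              ≡⟨ ∑-const c L ⟩
                length L * c               ∎

            -- An edge h ∋ v is used up when h - v enters G, so the edges inside X are not counted twice.
            within-edge : ∀ h →
              𝟙 (available? P G h) * (𝟙 (v ∈? h) * 𝟙 ((h - v) ⊆? X))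
                + 𝟙 (available? (v ∷ P) (L ++ G) h) * 𝟙 (h ⊆? X)
              ≤ 𝟙 (available? P G h) * 𝟙 (h ⊆? X)
            within-edge h = 𝟙-disjoint (available? P G h) (available? (v ∷ P) (L ++ G) h) (v ∈? h)
                ((h - v) ⊆? X) (h ⊆? X)
              restore earlier (λ { (v∉h ∷ _ , _) → v∉h })
              where
              restore : v ∈ h → (h - v) ⊆ X → h ⊆ X
              restore _ h-v⊆X {u} u∈h with u ≟ᶠ v
              ... | yes refl = v∈X
              ... | no u≢v   = h-v⊆X (x∈p∧x≢y⇒x∈p-y u∈h u≢v)
              earlier : Available (v ∷ P) (L ++ G) h → Available P G h
              earlier (_ ∷ P∌ , load≤) = P∌ , ≤-trans (*-monoʳ-≤ (r * n)
                (≤-trans (m≤n+m (load r G h) (load r L h)) (≤-reflexive (sym (∑-++ (W r h) L G))))) load≤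

            within′ : #within (L ++ G) X + #within A′ X ≤ #within H X
            within′ = begin
              #within (L ++ G) X + #within A′ X
                ≡⟨ cong₂ _+_ (trans (length-filter-∑ (_⊆? X) (L ++ G)) (∑-++ (λ h → 𝟙 (h ⊆? X)) L G))
                  (length-filter-∑ (_⊆? X) A′) ⟩
              (∑ L inX + ∑ G inX) + ∑ A′ inX
                ≡⟨ eq (∑ L inX) (∑ G inX) (∑ A′ inX) ⟩
              ∑ G inX + (∑ L inX + ∑ A′ inX)
                ≤⟨ +-monoʳ-≤ (∑ G inX) (begin
                  ∑ L inX + ∑ A′ inX
                    ≡⟨ cong₂ _+_
                         (trans (∑-map inX (_- v) (filter (v ∈?_) A))
                           (trans (∑-filter (v ∈?_) _ A) (∑-filter (available? P G) _ H)))
                         (∑-filter (available? (v ∷ P) (L ++ G)) inX H) ⟩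
                  ∑ H (λ h → 𝟙 (available? P G h) * (𝟙 (v ∈? h) * inX (h - v)))
                    + ∑ H (λ h → 𝟙 (available? (v ∷ P) (L ++ G) h) * inX h)
                    ≡⟨ ∑-distrib-+ _ _ H ⟨
                  ∑ H (λ h → 𝟙 (available? P G h) * (𝟙 (v ∈? h) * inX (h - v))
                             + 𝟙 (available? (v ∷ P) (L ++ G) h) * inX h)
                    ≤⟨ ∑-mono H (λ {h} _ → within-edge h) ⟩
                  ∑ H (λ h → 𝟙 (available? P G h) * inX h)
                    ≡⟨ ∑-filter (available? P G) inX H ⟨
                  ∑ A inX ∎) ⟩
              ∑ G inX + ∑ A inX
                ≡⟨ cong₂ _+_ (length-filter-∑ (_⊆? X) G) (length-filter-∑ (_⊆? X) A) ⟨
              #within G X + #within A X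
                ≤⟨ within S ⟩
              #within H X ∎
              where
              inX : Subset N → ℕ
              inX h = 𝟙 (h ⊆? X)
              eq : ∀ a b c → (a + b) + c ≡ b + (a + c)
              eq = solve-∀

          step : State k X (v ∷ P) (L ++ G)
          step = record
            { picked = v∈X ∷ picked S
            ; sizes = ++⁺ (tabulateˡ size-L) (sizes S)
            ; inside-H = ++⁺ (tabulateˡ inside-L) (inside-H S)
            ; upper = begin
                n * r * length (L ++ G)                  ≡⟨ cong (n * r *_) length-LG ⟩
                n * r * (length L + length G)            ≡⟨ *-distribˡ-+ (n * r) (length L) (length G) ⟩
                n * r * length L + n * r * length G      ≤⟨ +-mono-≤ L≤ (upper S) ⟩
                K * e + length P * (K * e)               ∎
            ; lower = begin
                e + length P * e                                   ≤⟨ +-mono-≤ v-dense (lower S) ⟩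
                8 * (n * r) * deg A v + 8 * (n * r) * length G
                    ≡⟨ cong (λ x → 8 * (n * r) * x + 8 * (n * r) * length G) length-L ⟨
                8 * (n * r) * length L + 8 * (n * r) * length G
                    ≡⟨ *-distribˡ-+ (8 * (n * r)) (length L) (length G) ⟨
                8 * (n * r) * (length L + length G)                ≡⟨ cong (8 * (n * r) *_) length-LG ⟨
                8 * (n * r) * length (L ++ G)                      ∎
            ; pairs = pairs′
            ; within = within′
            }
            where
            L≤ : n * r * length L ≤ K * e
            L≤ = begin
              n * r * length L   ≡⟨ cong (n * r *_) length-L ⟩
              n * r * deg A v    ≤⟨ *-monoʳ-≤ (n * r) (deg-filter-≤ (available? P G) H v) ⟩
              n * r * deg H v    ≤⟨ deg-bound (K * e) H light v ⟩
              K * e              ∎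
            size-L : ∀ {l} → l ∈ˡ L → ∣ l ∣ ≡ k
            size-L l∈ with ∈-link⁻ l∈
            ... | h , h∈H , _ , v∈h , refl = suc-injective (trans (suc∣p-x∣≡∣p∣ h v∈h) (lookupˡ sizes-H h∈H))
            inside-L : ∀ {l} → l ∈ˡ L → ∃ λ h → h ∈ˡ H × l ⊆ h
            inside-L l∈ with ∈-link⁻ l∈
            ... | h , h∈H , _ , _ , refl = h , h∈H , p─q⊆p h ⁅ v ⁆

        module _ {X : Subset N} {P : List (Fin N)} {G : List (Subset N)} (S : State k X P G)
                 (P≤n : length P ≤ n) (0<K : 0 < K) (0<e : 0 < e) (8K≤r : 8 * K ≤ r)
                 (3e≤4H : 3 * e ≤ 4 * length H) where

          private
            saturated? : Decidable (λ h → ¬ (r * n * load r G h ≤ 8 * K * K * e))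
            saturated? h = ¬? (r * n * load r G h ≤? 8 * K * K * e)

            used : ℕ
            used = ∑ P (deg H)

            #saturated : ℕ
            #saturated = length (filter saturated? H)

            cover : ∀ h → 1 ≤ 𝟙 (available? P G h) + (∑ P (λ v → 𝟙 (v ∈? h)) + 𝟙 (saturated? h))
            cover h = 𝟙-cover-× (allˡ? (λ v → ¬? (v ∈? h)) P) (r * n * load r G h ≤? 8 * K * K * e)
                (∑ P (λ v → 𝟙 (v ∈? h)))
              (𝟙-cover-all (_∈? h) P)

            length-H : length H ≤ length (available P G) + (used + #saturated)
            length-H = begin
              length H             ≡⟨ trans (∑-const 1 H) (*-identityʳ (length H)) ⟨
              ∑ H (λ _ → 1)        ≤⟨ ∑-mono H (λ {h} _ → cover h) ⟩
              ∑ H (λ h → 𝟙 (available? P G h) + (∑ P (λ v → 𝟙 (v ∈? h)) + 𝟙 (saturated? h)))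
                ≡⟨ trans (∑-distrib-+ (𝟙 ∘ available? P G) (λ h → ∑ P (λ v → 𝟙 (v ∈? h)) + 𝟙 (saturated? h)) H)
                     (cong (∑ H (𝟙 ∘ available? P G) +_)
                         (∑-distrib-+ (λ h → ∑ P (λ v → 𝟙 (v ∈? h))) (𝟙 ∘ saturated?) H)) ⟩
              ∑ H (𝟙 ∘ available? P G) + (∑ H (λ h → ∑ P (λ v → 𝟙 (v ∈? h))) + ∑ H (𝟙 ∘ saturated?))
                ≡⟨ cong₂ _+_ (length-filter-∑ (available? P G) H) (cong₂ _+_
                     (trans (∑-cong P (λ v → length-filter-∑ (v ∈?_) H)) (∑-swap (λ v h → 𝟙 (v ∈? h)) P H))
                         (length-filter-∑ saturated? H)) ⟨
              length (available P G) + (used + #saturated) ∎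

            -- At most `n` picks, each of degree at most `K e / (n r)`, use at most `K e / r` edges;
            -- `8 * K ≤ r` makes this at most `e / 8`.
            8used≤e : 8 * used ≤ e
            8used≤e = cancelˡ (n * K) (0<* 0<n 0<K) (begin
              n * K * (8 * used)                      ≡⟨ eq₁ n K used ⟩
              n * (8 * K) * used                      ≤⟨ *-monoˡ-≤ used (*-monoʳ-≤ n 8K≤r) ⟩
              n * r * used                            ≡⟨ ∑-distribˡ-* (n * r) (deg H) P ⟨
              ∑ P (λ v → n * r * deg H v)             ≤⟨ ∑-mono P (λ {v} _ → deg-bound (K * e) H light v) ⟩
              ∑ P (λ _ → K * e)                       ≡⟨ ∑-const (K * e) P ⟩
              length P * (K * e)                      ≤⟨ *-monoˡ-≤ (K * e) P≤n ⟩
              n * (K * e)                             ≡⟨ *-assoc n K e ⟨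
              n * K * e                               ∎)
              where
              eq₁ : ∀ n K u → n * K * (8 * u) ≡ n * (8 * K) * u
              eq₁ = solve-∀

            rG≤Ke : r * length G ≤ K * e
            rG≤Ke = cancelˡ n 0<n (begin
              n * (r * length G)    ≡⟨ *-assoc n r (length G) ⟨
              n * r * length G      ≤⟨ upper S ⟩
              length P * (K * e)    ≤⟨ *-monoˡ-≤ (K * e) P≤n ⟩
              n * (K * e)           ∎)

            -- Exchanging the order of summation turns loads of edges of `H` in `G` into loads of
            -- edges of `G` in `H`. Each edge of `G` is contained in a light edge, so its load in
            -- `H` is at most `K e / n`, and `G` has at most `K e / r` edges. Markov finishes the
            -- estimate.
            8saturated≤e : 8 * #saturated ≤ e
            8saturated≤e = cancelˡ (K * K * e) (0<* (0<* 0<K 0<K) 0<e) (begin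
              K * K * e * (8 * #saturated)              ≡⟨ eq₁ K e #saturated ⟩
              8 * K * K * e * #saturated                ≤⟨ markov saturated? H (<⇒≤ ∘ ≰⇒>) ⟩
              ∑ H (λ h → r * n * load r G h)            ≡⟨ ∑-distribˡ-* (r * n) (load r G) H ⟩
              r * n * ∑ H (load r G)                    ≡⟨ cong (r * n *_) (load-swap r G H) ⟩
              r * n * ∑ G (load r H)                    ≡⟨ *-assoc r n _ ⟩
              r * (n * ∑ G (load r H))                  ≡⟨ cong (r *_) (∑-distribˡ-* n (load r H) G) ⟨
              r * ∑ G (λ g → n * load r H g)
                ≤⟨ *-monoʳ-≤ r (∑-mono G (λ g∈ → load≤ (lookupˡ (inside-H S) g∈))) ⟩
              r * ∑ G (λ _ → K * e)                     ≡⟨ cong (r *_) (∑-const (K * e) G) ⟩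
              r * (length G * (K * e))                  ≡⟨ *-assoc r (length G) (K * e) ⟨
              r * length G * (K * e)                    ≤⟨ *-monoˡ-≤ (K * e) rG≤Ke ⟩
              K * e * (K * e)                           ≡⟨ eq₂ K e ⟩
              K * K * e * e                             ∎)
              where
              eq₁ : ∀ K e s → K * K * e * (8 * s) ≡ 8 * K * K * e * s
              eq₁ = solve-∀
              eq₂ : ∀ K e → K * e * (K * e) ≡ K * K * e * e
              eq₂ = solve-∀
              load≤ : ∀ {g} → (∃ λ h → h ∈ˡ H × g ⊆ h) → n * load r H g ≤ K * e
              load≤ (h , h∈H , g⊆h) = ≤-trans (*-monoʳ-≤ n (load-mono r 0<r H g⊆h)) (lookupˡ light h∈H)

          -- Of at least `3 e / 4` edges, at most `e / 8` contain a pick and at most `e / 8` are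
          -- saturated.
          available-many : e ≤ 2 * length (available P G)
          available-many = cancelˡ 4 z<s (+-cancelʳ-≤ (2 * e) _ _ (begin
            4 * e + 2 * e                                             ≡⟨ eq₁ e ⟩
            2 * (3 * e)                                               ≤⟨ *-monoʳ-≤ 2 3e≤4H ⟩
            2 * (4 * length H)                                        ≡⟨ *-assoc 2 4 (length H) ⟨
            8 * length H                                              ≤⟨ *-monoʳ-≤ 8 length-H ⟩
            8 * (a + (used + #saturated))                             ≡⟨ eq₂ a used #saturated ⟩
            4 * (2 * a) + (8 * used + 8 * #saturated)
              ≤⟨ +-monoʳ-≤ (4 * (2 * a)) (+-mono-≤ 8used≤e 8saturated≤e) ⟩
            4 * (2 * a) + (e + e)
                ≡⟨ cong (λ x → 4 * (2 * a) + (e + x)) (+-identityʳ e) ⟨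
            4 * (2 * a) + 2 * e                                       ∎))
            where
            a = length (available P G)
            eq₁ : ∀ e → 4 * e + 2 * e ≡ 2 * (3 * e)
            eq₁ = solve-∀
            eq₂ : ∀ a u s → 8 * (a + (u + s)) ≡ 4 * (2 * a) + (8 * u + 8 * s)
            eq₂ = solve-∀

          available-dense-large : N ≤ 2 * (n * r) → n * r ≤ 4 * K * ∣ dense e (available P G) ∣
          available-dense-large N≤ = dense-large K e (available P G) 0<e N≤
            (mapˡ (λ ∣h∣≡ → ≤-trans (s≤s z≤n) (≤-reflexive (sym ∣h∣≡))) (filter⁺ (available? P G) sizes-H))
            available-many
            (λ v → ≤-trans (*-monoʳ-≤ (n * r) (deg-filter-≤ (available? P G) H v))
                (deg-bound (K * e) H light v))

  -- Large sets of dense vertices, by recursion on the uniformity.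

  abstract

    -- The constant in the hypothesis for G, obtained from lower and pairs of State at K = 4B.
    nextB : ℕ → ℕ
    nextB B = 8 * ((16 * (4 * B) + 1) * (4 * B))

    nextB-def : ∀ B → nextB B ≡ 8 * ((16 * (4 * B) + 1) * (4 * B))
    nextB-def B = refl

    0<nextB : ∀ {B} → 0 < B → 0 < nextB B
    0<nextB {B} 0<B = 0<* {8} z<s (0<* (≤-trans z<s (m≤n+m 1 (16 * (4 * B)))) (0<* {4} z<s 0<B))

  -- loss j B plays the role of 1 / c in |D| ≥ cN for (j + 1)-uniform hypergraphs.
  loss : ℕ → ℕ → ℕ
  loss zero    B = 32 * B
  loss (suc j) B = 32 * B + 8 * loss j (nextB B)

  32B≤loss : ∀ j B → 32 * B ≤ loss j B
  32B≤loss zero    B = ≤-refl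
  32B≤loss (suc j) B = m≤m+n (32 * B) _

  module Removal (n r : ℕ) (0<n : 0 < n) (0<r : 0 < r) {N : ℕ} where

    open Round n r 0<n 0<r {N}

    -- A run is `full` when all its steps were spent on picks, and `stuck` when no dense vertex of
    -- the queried set was left before that. Both carry the picks and the multihypergraph built so
    -- far.
    data Outcome : Set where
      stuck full : List (Fin N) → List (Subset N) → Outcome

    run : (K e : ℕ) (H : List (Subset N)) (X : Subset N) → ℕ → List (Fin N) → List (Subset N) → Outcome
    run K e H X zero    P G = full P G
    run K e H X (suc s) P G with find (pick? K e H X P G) (allFin N)
    ... | nothing = stuck P G
    ... | just v  = run K e H X s (v ∷ P) (link v (available K e H P G) ++ G)

    lightEdges : ℕ → List (Subset N) → List (Subset N)
    lightEdges B H = filter (light? (4 * B) H) H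

    -- The pair (picks, D).
    removal  : ℕ → ℕ → List (Subset N) → Subset N → List (Fin N) × Subset N
    continue : ℕ → ℕ → List (Subset N) → Subset N → Outcome → List (Fin N) × Subset N

    removal zero    B H X = [] , dense (length H) (lightEdges B H)
    removal (suc j) B H X = continue j B H X (run (4 * B) (length H) (lightEdges B H) X n [] [])

    continue j B H X (stuck P G) = P , dense (length H) (available (4 * B) (length H) (lightEdges B H) P G)
    continue j B H X (full P G)  = P ++ proj₁ (removal j (nextB B) G X) , proj₂ (removal j (nextB B) G X)

    picks : Outcome → List (Fin N)
    picks (stuck P G) = P
    picks (full P G)  = P

    module _ (K e : ℕ) (H : List (Subset N)) where

      picks-extend : ∀ X s P G {v} → v ∈ˡ P → v ∈ˡ picks (run K e H X s P G)
      picks-extend X zero    P G v∈ = v∈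
      picks-extend X (suc s) P G v∈ with find (pick? K e H X P G) (allFin N)
      ... | nothing = v∈
      ... | just u  = picks-extend X s (u ∷ P) _ (there v∈)

      -- The run only queries X for the first suitable vertex, which it then adds to the picks.
      run-stable : ∀ {X X′} → X′ ⊆ X → ∀ s P G → Allˡ (_∈ X′) (picks (run K e H X s P G)) →
                   run K e H X′ s P G ≡ run K e H X s P G
      run-stable X′⊆X zero    P G picks⊆ = refl
      run-stable {X} {X′} X′⊆X (suc s) P G picks⊆ with find (pick? K e H X P G) (allFin N) in eq
      ... | nothing rewrite find-restrict-nothing (pick? K e H X P G) (pick? K e H X′ P G) (allFin N)
                              (λ { (v∈ , d) → X′⊆X v∈ , d }) eq = refl
      ... | just v rewrite find-restrict-just (pick? K e H X P G) (pick? K e H X′ P G) (allFin N)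
                              (λ { (v∈ , d) → X′⊆X v∈ , d })
                              (lookupˡ picks⊆ (picks-extend X s (v ∷ P) _ (here refl)) ,
                               proj₂ (find-just (pick? K e H X P G) (allFin N) eq)) eq
                           = run-stable X′⊆X s (v ∷ P) _ picks⊆

      Reached : ℕ → Subset N → Outcome → Set
      Reached k X (stuck P G) = State K e H k X P G × length P ≤ n ×
          (∀ {v} → v ∈ X → v ∉ dense e (available K e H P G))
      Reached k X (full P G)  = State K e H k X P G × length P ≡ n

      module _ {k : ℕ} (sizes-H : Allˡ (λ h → ∣ h ∣ ≡ suc k) H)
               (light : Allˡ (λ h → n * load r H h ≤ K * e) H) where

        run-reaches : ∀ X s P G → State K e H k X P G → length P + s ≡ n → Reached k X (run K e H X s P G)
        run-reaches X zero    P G S eq = S , trans (sym (+-identityʳ (length P))) eq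
        run-reaches X (suc s) P G S eq with find (pick? K e H X P G) (allFin N) in found
        ... | nothing = S , ≤-trans (m≤m+n (length P) (suc s)) (≤-reflexive eq) ,
          λ {v} v∈X v∈D → find-nothing (pick? K e H X P G) (allFin N) found (∈-allFin v)
            (v∈X , ∈⟦⟧⁻ (dense? e (available K e H P G)) v∈D)
        ... | just v = let v∈X , d = find-just (pick? K e H X P G) (allFin N) found in
          run-reaches X s (v ∷ P) _ (step K e H sizes-H light S v∈X d) (trans (sym (+-suc (length P) s)) eq)

    -- As `n * r` is comparable to `N`, `large` says that `D` is a constant fraction of all
    -- vertices. If `X` spans at most `length H / (loss j B * r ^ suc j)` edges, then `few` leaves
    -- at most `n` points of `X` in `D`. `stable` is reproducibility from the picks. `covered`
    -- ensures that, when `H` lives on a set `S`, so does `D`.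
    record Good (j B : ℕ) (H : List (Subset N)) (X : Subset N) (P : List (Fin N)) (D : Subset N) : Set where
      field
        large   : n * r ≤ loss j B * ∣ D ∣
        few     : ∣ X ∩ D ∣ * length H ≤ loss j B * (r ^ suc j * n) * #within H X
        picked  : Allˡ (_∈ X) P
        #picks  : length P ≤ j * n
        stable  : ∀ {X′} → X′ ⊆ X → Allˡ (_∈ X′) P → removal j B H X′ ≡ (P , D)
        covered : ∀ {v} → v ∈ D → ∃ λ h → h ∈ˡ H × v ∈ h

    open Good

    dense-covered : ∀ e A {v} → 0 < e → v ∈ dense e A → ∃ λ h → h ∈ˡ A × v ∈ h
    dense-covered e A {v} 0<e v∈ with filter (v ∈?_) A in eq | ∈⟦⟧⁻ (dense? e A) v∈
    ... | []     | e≤ = contradiction (≤-trans 0<e (≤-trans e≤ (≤-reflexive (*-zeroʳ (8 * (n * r)))))) n≮0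
    ... | h ∷ hs | _  = h , ∈-filter⁻ (v ∈?_) {xs = A} (subst (h ∈ˡ_) (sym eq) (here refl))

    module _ (N≤ : N ≤ 2 * (n * r)) where

      removal-good : ∀ j B H X → 0 < B → loss j B ≤ r → 0 < length H → Allˡ (λ h → ∣ h ∣ ≡ suc j) H →
                     n * pairSum r H ≤ B * (length H * length H) →
                     Good j B H X (proj₁ (removal j B H X)) (proj₂ (removal j B H X))

      -- The outcome is a variable tied to the run by an equation, so that it can be split into
      -- cases while `stable` still compares the run on `X` with that on a smaller set.
      continue-good : ∀ j B H X (0<B : 0 < B) → loss (suc j) B ≤ r → 0 < length H →
                      (sizes-H : Allˡ (λ h → ∣ h ∣ ≡ suc (suc j)) H) →
                      n * pairSum r H ≤ B * (length H * length H) →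
                      ∀ o → run (4 * B) (length H) (lightEdges B H) X n [] [] ≡ o →
                      Reached (4 * B) (length H) (lightEdges B H) (suc j) X o →
                      Good (suc j) B H X (proj₁ (continue j B H X o)) (proj₂ (continue j B H X o))

      module _ (j B : ℕ) (H : List (Subset N)) (X : Subset N) (0<B : 0 < B) (loss≤r : loss j B ≤ r)
               (0<e : 0 < length H) (sizes-H : Allˡ (λ h → ∣ h ∣ ≡ suc j) H)
               (Δ≤ : n * pairSum r H ≤ B * (length H * length H)) where

        private
          K e : ℕ
          K = 4 * B
          e = length H
          H₁ : List (Subset N)
          H₁ = lightEdges B H

        sizes₁ : Allˡ (λ h → ∣ h ∣ ≡ suc j) H₁
        sizes₁ = filter⁺ (light? K H) sizes-H

        light₁ : Allˡ (λ h → n * load r H₁ h ≤ K * e) H₁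
        light₁ = mapˡ (λ {h} load≤ → ≤-trans (*-monoʳ-≤ n (load-filter-≤ r (light? K H) H h)) load≤)
                      (all-filter (light? K H) H)

        3e≤4H₁ : 3 * e ≤ 4 * length H₁
        3e≤4H₁ = light-count B H 0<B 0<e Δ≤

        8K≤r : 8 * K ≤ r
        8K≤r = ≤-trans (≤-reflexive (sym (*-assoc 8 4 B))) (≤-trans (32B≤loss j B) loss≤r)

        4K≤loss : 4 * K ≤ loss j B
        4K≤loss = ≤-trans (*-monoˡ-≤ K {4} {8} (m≤m+n 4 4))
            (≤-trans (≤-reflexive (sym (*-assoc 8 4 B))) (32B≤loss j B))

        ⊆H : ∀ {h} → h ∈ˡ H₁ → h ∈ˡ H
        ⊆H h∈ = proj₁ (∈-filter⁻ (light? K H) {xs = H} h∈)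

      removal-good zero B H X 0<B loss≤r 0<e sizes-H Δ≤ = record
        { large = ≤-trans (dense-large K e H₁ 0<e N≤ (mapˡ (λ ∣h∣≡ → ≤-reflexive (sym ∣h∣≡)) sz)
                    e≤2H₁ (deg-bound (K * e) H₁ lt))
                    (*-monoˡ-≤ ∣ D ∣ (4K≤loss zero B H X 0<B loss≤r 0<e sizes-H Δ≤))
        -- Each vertex of `X ∩ D` lies in at least `e / (8 n r)` singleton edges, and all of these
        -- are inside `X`.
        ; few = begin
            ∣ X ∩ D ∣ * e                                            ≡⟨ cong (_* e) (∣p∣≡∑ (X ∩ D)) ⟩
            ∑ (allFin N) (λ v → 𝟙 (v ∈? (X ∩ D))) * e
              ≡⟨ *-comm (∑ (allFin N) (λ v → 𝟙 (v ∈? (X ∩ D)))) e ⟩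
            e * ∑ (allFin N) (λ v → 𝟙 (v ∈? (X ∩ D)))
                ≡⟨ ∑-distribˡ-* e (λ v → 𝟙 (v ∈? (X ∩ D))) (allFin N) ⟨
            ∑ (allFin N) (λ v → e * 𝟙 (v ∈? (X ∩ D)))
              ≤⟨ ∑-mono (allFin N) (λ {v} _ → pointwise v) ⟩
            ∑ (allFin N) (λ v → 8 * (n * r) * (𝟙 (v ∈? X) * deg H₁ v))
              ≡⟨ ∑-distribˡ-* (8 * (n * r)) (λ v → 𝟙 (v ∈? X) * deg H₁ v) (allFin N) ⟩
            8 * (n * r) * ∑ (allFin N) (λ v → 𝟙 (v ∈? X) * deg H₁ v)
              ≤⟨ *-monoʳ-≤ (8 * (n * r)) (≤-trans (∑-deg-singletons H₁ X sz)
                (#within-filter-≤ (light? K H) H X)) ⟩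
            8 * (n * r) * #within H X
              ≡⟨ cong (_* #within H X) (cong (8 *_) (trans (*-comm n r) (cong (_* n) (sym (*-identityʳ r))))) ⟩
            8 * (r ^ 1 * n) * #within H X
              ≤⟨ *-monoˡ-≤ (#within H X) (*-monoˡ-≤ (r ^ 1 * n) 8≤32B) ⟩
            32 * B * (r ^ 1 * n) * #within H X                       ∎
        ; picked = []
        ; #picks = z≤n
        ; stable = λ _ _ → refl
        ; covered = λ v∈D → let h , h∈H₁ , v∈h = dense-covered e H₁ 0<e v∈D in
            h , ⊆H zero B H X 0<B loss≤r 0<e sizes-H Δ≤ h∈H₁ , v∈h
        }
        where
        K = 4 * B
        e = length H
        H₁ = lightEdges B H
        D = dense e H₁
        sz = sizes₁ zero B H X 0<B loss≤r 0<e sizes-H Δ≤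
        lt = light₁ zero B H X 0<B loss≤r 0<e sizes-H Δ≤
        e≤2H₁ : e ≤ 2 * length H₁
        e≤2H₁ = cancelˡ 2 z<s (begin
          2 * e                    ≤⟨ *-monoˡ-≤ e {2} {3} (n≤1+n 2) ⟩
          3 * e                    ≤⟨ 3e≤4H₁ zero B H X 0<B loss≤r 0<e sizes-H Δ≤ ⟩
          4 * length H₁            ≡⟨ *-assoc 2 2 (length H₁) ⟩
          2 * (2 * length H₁)      ∎)
        8≤32B : 8 ≤ 32 * B
        8≤32B = *-mono-≤ {8} {32} (m≤m+n 8 24) 0<B
        pointwise : ∀ v → e * 𝟙 (v ∈? (X ∩ D)) ≤ 8 * (n * r) * (𝟙 (v ∈? X) * deg H₁ v)
        pointwise v = ≤-trans (≤-reflexive (*-comm e _)) (𝟙*-≤ (v ∈? (X ∩ D)) (λ v∈ →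
          let v∈X , v∈D = x∈p∩q⁻ X D v∈ in
          ≤-trans (∈⟦⟧⁻ (dense? e H₁) v∈D) (≤-reflexive (cong (8 * (n * r) *_)
            (sym (trans (cong (_* deg H₁ v) (𝟙-yes (v ∈? X) v∈X)) (*-identityˡ (deg H₁ v))))))))

      removal-good (suc j) B H X 0<B loss≤r 0<e sizes-H Δ≤ =
        continue-good j B H X 0<B loss≤r 0<e sizes-H Δ≤ _ refl
          (run-reaches (4 * B) (length H) (lightEdges B H) sz lt X n [] []
            (initial (4 * B) (length H) (lightEdges B H) sz lt X) refl)
        where
        sz = sizes₁ (suc j) B H X 0<B loss≤r 0<e sizes-H Δ≤
        lt = light₁ (suc j) B H X 0<B loss≤r 0<e sizes-H Δ≤

      continue-good j B H X 0<B loss≤r 0<e sizes-H Δ≤ (stuck P G) run≡ (S , P≤n , X∌D) = record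
        { large = ≤-trans
            (available-dense-large K e H₁ sz lt S P≤n (0<* {4} z<s 0<B) 0<e
              (8K≤r (suc j) B H X 0<B loss≤r 0<e sizes-H Δ≤) (3e≤4H₁ (suc j) B H X 0<B loss≤r 0<e sizes-H Δ≤)
                  N≤)
            (*-monoˡ-≤ ∣ D ∣ (4K≤loss (suc j) B H X 0<B loss≤r 0<e sizes-H Δ≤))
        ; few = ≤-trans (≤-reflexive (cong (_* e) empty)) z≤n
        ; picked = State.picked S
        ; #picks = ≤-trans P≤n (m≤m+n n (j * n))
        ; stable = stable′
        ; covered = λ v∈D → let h , h∈A , v∈h = dense-covered e (available K e H₁ P G) 0<e v∈D in
            h , ⊆H (suc j) B H X 0<B loss≤r 0<e sizes-H Δ≤
                (proj₁ (∈-filter⁻ (available? K e H₁ P G) {xs = H₁} h∈A)) , v∈h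
        }
        where
        K = 4 * B
        e = length H
        H₁ = lightEdges B H
        D = dense e (available K e H₁ P G)
        sz = sizes₁ (suc j) B H X 0<B loss≤r 0<e sizes-H Δ≤
        lt = light₁ (suc j) B H X 0<B loss≤r 0<e sizes-H Δ≤
        empty : ∣ X ∩ D ∣ ≡ 0
        empty =
            trans
                (cong ∣_∣ (Empty-unique {p = X ∩ D}
                    (λ { (v , v∈) → let v∈X , v∈D = x∈p∩q⁻ X D v∈ in X∌D v∈X v∈D }))) (∣⊥∣≡0 N)
        stable′ : ∀ {X′} → X′ ⊆ X → Allˡ (_∈ X′) P → removal (suc j) B H X′ ≡ (P , D)
        stable′ {X′} X′⊆X P⊆X′ = cong (continue j B H X′)
          (trans (run-stable K e H₁ X′⊆X n [] [] (subst (Allˡ (_∈ X′) ∘ picks) (sym run≡) P⊆X′)) run≡)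

      continue-good j B H X 0<B loss≤r 0<e sizes-H Δ≤ (full P G) run≡ (S , P≡n) = record
        { large = ≤-trans (large ih) (*-monoˡ-≤ ∣ D ∣ loss′≤loss)
        ; few = begin
            -- The bound for `G` passes to `H` because `G` has no more edges inside `X` than `H`
            -- has. Replacing `length G` by `e` costs `8 * r`, which raises the power of `r` by one
            -- and puts the factor 8 into `loss`.
            ∣ X ∩ D ∣ * e                                                   ≤⟨ *-monoʳ-≤ ∣ X ∩ D ∣ e≤8rG ⟩
            ∣ X ∩ D ∣ * (8 * r * length G)                                  ≡⟨ eq₁ ∣ X ∩ D ∣ r (length G) ⟩
            8 * r * (∣ X ∩ D ∣ * length G)                                  ≤⟨ *-monoʳ-≤ (8 * r) (few ih) ⟩
            8 * r * (loss j (nextB B) * (r ^ suc j * n) * #within G X)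
              ≤⟨ *-monoʳ-≤ (8 * r) (*-monoʳ-≤ (loss j (nextB B) * (r ^ suc j * n)) within≤) ⟩
            8 * r * (loss j (nextB B) * (r ^ suc j * n) * #within H X)
              ≡⟨ eq₂ r (loss j (nextB B)) (r ^ suc j) n (#within H X) ⟩
            8 * loss j (nextB B) * (r ^ suc (suc j) * n) * #within H X
              ≤⟨ *-monoˡ-≤ (#within H X) (*-monoˡ-≤ (r ^ suc (suc j) * n) (m≤n+m _ (32 * B))) ⟩
            loss (suc j) B * (r ^ suc (suc j) * n) * #within H X            ∎
        ; picked = ++⁺ (State.picked S) (picked ih)
        ; #picks = ≤-trans (≤-reflexive (length-++ P)) (+-mono-≤ (≤-reflexive P≡n) (#picks ih))
        ; stable = stable′
        ; covered = λ v∈D → let g , g∈G , v∈g = covered ih v∈D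
                                h , h∈H₁ , g⊆h = lookupˡ (State.inside-H S) g∈G in
            h , ⊆H (suc j) B H X 0<B loss≤r 0<e sizes-H Δ≤ h∈H₁ , g⊆h v∈g
        }
        where
        K = 4 * B
        e = length H
        H₁ = lightEdges B H
        P′ = proj₁ (removal j (nextB B) G X)
        D = proj₂ (removal j (nextB B) G X)
        eq₁ : ∀ x r g → x * (8 * r * g) ≡ 8 * r * (x * g)
        eq₁ = solve-∀
        eq₂ : ∀ r l s n w → 8 * r * (l * (s * n) * w) ≡ 8 * l * (r * s * n) * w
        eq₂ = solve-∀
        loss′≤loss : loss j (nextB B) ≤ loss (suc j) B
        loss′≤loss = ≤-trans (m≤n*m (loss j (nextB B)) 8) (m≤n+m _ (32 * B))
        -- All `n` picks were made, and each moved at least `e / (8 n r)` edges into `G`.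
        e≤8rG : e ≤ 8 * r * length G
        e≤8rG = cancelˡ n 0<n (begin
          n * e                       ≡⟨ cong (_* e) P≡n ⟨
          length P * e                ≤⟨ State.lower S ⟩
          8 * (n * r) * length G      ≡⟨ eq n r (length G) ⟩
          n * (8 * r * length G)      ∎)
          where
          eq : ∀ n r g → 8 * (n * r) * g ≡ n * (8 * r * g)
          eq = solve-∀
        0<G : 0 < length G
        0<G = 0<*⁻ʳ (8 * r) (≤-trans 0<e e≤8rG)
        Δ′≤ : n * pairSum r G ≤ nextB B * (length G * length G)
        Δ′≤ = cancelˡ r 0<r (begin
          r * (n * pairSum r G)                                    ≡⟨ *-assoc r n (pairSum r G) ⟨
          r * n * pairSum r G                                      ≤⟨ State.pairs S ⟩
          length G * ((16 * K + 1) * (K * e))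
            ≤⟨ *-monoʳ-≤ (length G) (*-monoʳ-≤ (16 * K + 1) (*-monoʳ-≤ K e≤8rG)) ⟩
          length G * ((16 * K + 1) * (K * (8 * r * length G)))     ≡⟨ eq (length G) (16 * K + 1) K r ⟩
          r * (8 * ((16 * K + 1) * K) * (length G * length G))
              ≡⟨ cong (λ x → r * (x * (length G * length G))) (nextB-def B) ⟨
          r * (nextB B * (length G * length G))                    ∎)
          where
          eq : ∀ g a K r → g * (a * (K * (8 * r * g))) ≡ r * (8 * (a * K) * (g * g))
          eq = solve-∀
        within≤ : #within G X ≤ #within H X
        within≤ = begin
          #within G X                                            ≤⟨ m≤m+n (#within G X) _ ⟩
          #within G X + #within (available K e H₁ P G) X         ≤⟨ State.within S ⟩
          #within H₁ X                                           ≤⟨ #within-filter-≤ (light? K H) H X ⟩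
          #within H X                                            ∎
        ih : Good j (nextB B) G X P′ D
        ih = removal-good j (nextB B) G X (0<nextB 0<B) (≤-trans loss′≤loss loss≤r) 0<G (State.sizes S) Δ′≤
        stable′ : ∀ {X′} → X′ ⊆ X → Allˡ (_∈ X′) (P ++ P′) → removal (suc j) B H X′ ≡ (P ++ P′ , D)
        stable′ {X′} X′⊆X P⊆X′ = trans
          (cong (continue j B H X′)
            (trans (run-stable K e H₁ X′⊆X n [] [] (subst (Allˡ (_∈ X′) ∘ picks) (sym run≡) (++⁻ˡ P P⊆X′)))
                run≡))
          (cong (λ { (Q , E) → P ++ Q , E }) (stable ih X′⊆X (++⁻ʳ P P⊆X′)))

  -- Repeated removal until few edges remain.

  module Shrinking (n r : ℕ) (0<n : 0 < n) (0<r : 0 < r) {N : ℕ} (j b q : ℕ) (E : List (Subset N)) where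

    open Removal n r 0<n 0<r {N}

    -- As long as `S` contains more than a fraction `1 / q` of the edges, passing from `E` to the
    -- edges inside `S` costs a factor `q * q` in the constant, since the hypothesis compares with
    -- the squared number of edges.
    B : ℕ
    B = b * (q * q)

    -- The number bounds the rounds. The decision whether `S` is already sparse is an argument of
    -- `shrinkStep`; it depends on `S` only, so two runs on the same `S` share it.
    shrink : ℕ → Subset N → Subset N → List (Fin N) × Subset N
    shrinkStep : (L : ℕ) (X S : Subset N) → Dec (q * #within E S ≤ length E) → List (Fin N) × Subset N

    shrink zero    X S = [] , S
    shrink (suc L) X S = shrinkStep L X S (q * #within E S ≤? length E)

    shrinkStep L X S (yes _) = [] , S
    shrinkStep L X S (no _)  =
      let P , D  = removal j B (filter (_⊆? S) E) X
          P′ , S′ = shrink L X (S ─ D)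
      in P ++ P′ , S′

    record Shrunk (L : ℕ) (X S : Subset N) (P : List (Fin N)) (S′ : Subset N) : Set where
      field
        sparse : q * #within E S′ ≤ length E
        few    : ∣ X ─ S′ ∣ * length E
               ≤ ∣ X ─ S ∣ * length E + L * (q * (loss j B * (r ^ suc j * n) * #within E X))
        picked : Allˡ (_∈ X) P
        #picks : length P ≤ L * (j * n)

    module _ (N≤ : N ≤ 2 * (n * r)) (0<b : 0 < b) (0<q : 0 < q) (loss≤r : loss j B ≤ r)
             (sizes : Allˡ (λ h → ∣ h ∣ ≡ suc j) E)
             (Δ≤ : n * pairSum r E ≤ b * (length E * length E)) where

      open Good

      private
        c : ℕ
        c = loss j B

        good : ∀ X S → ¬ (q * #within E S ≤ length E) →
               Good j B (filter (_⊆? S) E) X (proj₁ (removal j B (filter (_⊆? S) E) X))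
                   (proj₂ (removal j B (filter (_⊆? S) E) X))
        good X S many = removal-good N≤ j B (filter (_⊆? S) E) X (0<* 0<b (0<* 0<q 0<q)) loss≤r
          (0<*⁻ʳ q (≤-trans (s≤s z≤n) (≰⇒> many)))
          (filter⁺ (_⊆? S) sizes)
          (begin
            n * pairSum r (filter (_⊆? S) E)      ≤⟨ *-monoʳ-≤ n (pairSum-filter-≤ r (_⊆? S) E) ⟩
            n * pairSum r E                       ≤⟨ Δ≤ ⟩
            b * (length E * length E)             ≤⟨ *-monoʳ-≤ b (*-mono-≤ (<⇒≤ (≰⇒> many)) (<⇒≤ (≰⇒> many))) ⟩
            b * (q * s * (q * s))                 ≡⟨ eq b q s ⟩
            B * (s * s)                           ∎)
          where
          s = #within E S
          eq : ∀ b q s → b * (q * s * (q * s)) ≡ b * (q * q) * (s * s)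
          eq = solve-∀

      -- Each removed set satisfies `N ≤ 2 * (n * r) ≤ 2 * (c * ∣ D ∣)` and lies in `S`, so
      -- `2 * c * ∣ S ∣` drops by at least `N` per round. The rounds therefore cannot run out before
      -- `S` is sparse.
      shrink-shrunk : ∀ L X S → 2 * c * ∣ S ∣ < L * N →
          Shrunk L X S (proj₁ (shrink L X S)) (proj₂ (shrink L X S))
      shrinkStep-shrunk : ∀ L X S → 2 * c * ∣ S ∣ < suc L * N → (S? : Dec (q * #within E S ≤ length E)) →
                          Shrunk (suc L) X S (proj₁ (shrinkStep L X S S?)) (proj₂ (shrinkStep L X S S?))

      shrink-shrunk zero    X S fuel = contradiction fuel n≮0
      shrink-shrunk (suc L) X S fuel = shrinkStep-shrunk L X S fuel (q * #within E S ≤? length E)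

      shrinkStep-shrunk L X S fuel (yes sparse) = record
        { sparse = sparse ; few = m≤m+n _ _ ; picked = [] ; #picks = z≤n }
      shrinkStep-shrunk L X S fuel (no many) = record
        { sparse = Shrunk.sparse rest
        ; few = begin
            ∣ X ─ S′ ∣ * e                              ≤⟨ Shrunk.few rest ⟩
            ∣ X ─ (S ─ D) ∣ * e + L * Q                 ≤⟨ +-monoˡ-≤ (L * Q) (*-monoˡ-≤ e ─≤) ⟩
            (∣ X ─ S ∣ + ∣ X ∩ D ∣) * e + L * Q         ≡⟨ eq₁ ∣ X ─ S ∣ ∣ X ∩ D ∣ e (L * Q) ⟩
            ∣ X ─ S ∣ * e + (∣ X ∩ D ∣ * e + L * Q)     ≤⟨ +-monoʳ-≤ (∣ X ─ S ∣ * e) (+-monoˡ-≤ (L * Q) lost) ⟩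
            ∣ X ─ S ∣ * e + (Q + L * Q)                 ∎
        ; picked = ++⁺ (picked G) (Shrunk.picked rest)
        ; #picks = ≤-trans (≤-reflexive (length-++ (proj₁ (removal j B (filter (_⊆? S) E) X))))
              (+-mono-≤ (#picks G) (Shrunk.#picks rest))
        }
        where
        G = good X S many
        D = proj₂ (removal j B (filter (_⊆? S) E) X)
        S′ = proj₂ (shrink L X (S ─ D))
        e = length E
        Q = q * (loss j B * (r ^ suc j * n) * #within E X)
        eq₁ : ∀ a d e l → (a + d) * e + l ≡ a * e + (d * e + l)
        eq₁ = solve-∀
        D⊆S : D ⊆ S
        D⊆S v∈D = let h , h∈ , v∈h = covered G v∈D in proj₂ (∈-filter⁻ (_⊆? S) {xs = E} h∈) v∈h
        ─≤ : ∣ X ─ (S ─ D) ∣ ≤ ∣ X ─ S ∣ + ∣ X ∩ D ∣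
        ─≤ = ≤-trans (p⊆q⇒∣p∣≤∣q∣ split) (∣p∪q∣≤∣p∣+∣q∣ (X ─ S) (X ∩ D))
          where
          split : X ─ (S ─ D) ⊆ (X ─ S) ∪ (X ∩ D)
          split {v} v∈ with v ∈? S | v ∈? D
          ... | no v∉S  | _       = x∈p∪q⁺ (inj₁ (x∈p∧x∉q⇒x∈p─q (p─q⊆p X (S ─ D) v∈) v∉S))
          ... | yes _   | yes v∈D = x∈p∪q⁺ (inj₂ (x∈p∩q⁺ (p─q⊆p X (S ─ D) v∈ , v∈D)))
          ... | yes v∈S | no v∉D  = contradiction (x∈p∧x∉q⇒x∈p─q v∈S v∉D) (x∈p─q⇒x∉q X (S ─ D) v∈)
        lost : ∣ X ∩ D ∣ * e ≤ Q
        lost = begin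
          ∣ X ∩ D ∣ * e                                ≤⟨ *-monoʳ-≤ ∣ X ∩ D ∣ (<⇒≤ (≰⇒> many)) ⟩
          ∣ X ∩ D ∣ * (q * #within E S)                ≡⟨ eq ∣ X ∩ D ∣ q (#within E S) ⟩
          q * (∣ X ∩ D ∣ * #within E S)                ≤⟨ *-monoʳ-≤ q (few G) ⟩
          q * (loss j B * (r ^ suc j * n) * #within (filter (_⊆? S) E) X)
            ≤⟨ *-monoʳ-≤ q (*-monoʳ-≤ (loss j B * (r ^ suc j * n)) (#within-filter-≤ (_⊆? S) E X)) ⟩
          Q ∎
          where
          eq : ∀ x q s → x * (q * s) ≡ q * (x * s)
          eq = solve-∀
        fuel′ : 2 * c * ∣ S ─ D ∣ < L * N
        fuel′ = +-cancelˡ-< N (2 * c * ∣ S ─ D ∣) (L * N) (begin-strict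
          N + 2 * c * ∣ S ─ D ∣
            ≤⟨ +-monoˡ-≤ (2 * c * ∣ S ─ D ∣) (≤-trans N≤ (*-monoʳ-≤ 2 (large G))) ⟩
          2 * (c * ∣ D ∣) + 2 * c * ∣ S ─ D ∣          ≡⟨ eq c ∣ D ∣ ∣ S ─ D ∣ ⟩
          2 * c * (∣ D ∣ + ∣ S ─ D ∣)
            ≤⟨ *-monoʳ-≤ (2 * c) (+-monoˡ-≤ ∣ S ─ D ∣ (p⊆q⇒∣p∣≤∣q∣ (λ v∈D → x∈p∩q⁺ (D⊆S v∈D , v∈D)))) ⟩
          2 * c * (∣ S ∩ D ∣ + ∣ S ─ D ∣)              ≡⟨ cong (2 * c *_) (∣p∩q∣+∣p─q∣ S D) ⟩
          2 * c * ∣ S ∣                                <⟨ fuel ⟩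
          N + L * N                                    ∎)
          where
          eq : ∀ c d s → 2 * (c * d) + 2 * c * s ≡ 2 * c * (d + s)
          eq = solve-∀
        rest = shrink-shrunk L X (S ─ D) fuel′

      -- Round by round: by `stable` the first removal agrees on both sets, so the remaining rounds
      -- start from the same `S ─ D`.
      shrink-stable : ∀ L {X X′} S → X′ ⊆ X → Allˡ (_∈ X′) (proj₁ (shrink L X S)) → shrink L X′ S ≡ shrink L X S
      shrinkStep-stable : ∀ L {X X′} S → X′ ⊆ X → (S? : Dec (q * #within E S ≤ length E)) →
                          Allˡ (_∈ X′) (proj₁ (shrinkStep L X S S?)) →
                              shrinkStep L X′ S S? ≡ shrinkStep L X S S?

      shrink-stable zero    S X′⊆X picks⊆ = refl
      shrink-stable (suc L) S X′⊆X picks⊆ = shrinkStep-stable L S X′⊆X (q * #within E S ≤? length E) picks⊆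

      shrinkStep-stable L S X′⊆X (yes _) picks⊆ = refl
      shrinkStep-stable L {X} {X′} S X′⊆X (no many) picks⊆ = trans
        (cong (next X′) (stable (good X S many) X′⊆X (++⁻ˡ P picks⊆)))
        (cong (λ PS → P ++ proj₁ PS , proj₂ PS) (shrink-stable L (S ─ D) X′⊆X (++⁻ʳ P picks⊆)))
        where
        P = proj₁ (removal j B (filter (_⊆? S) E) X)
        D = proj₂ (removal j B (filter (_⊆? S) E) X)
        next : Subset N → List (Fin N) × Subset N → List (Fin N) × Subset N
        next Y (P , D) = P ++ proj₁ (shrink L Y (S ─ D)) , proj₂ (shrink L Y (S ─ D))

  -- Choice of constants and the container statement for natural numbers.

  quotient : ∀ a d s → 0 < d → 0 < s → s * d ≤ a → ∃ λ u → s ≤ u × u * d ≤ a × a ≤ 2 * (u * d)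
  quotient a d s 0<d 0<s sd≤a = a / d , s≤u , m/n*n≤m a d , (begin
    a                          ≡⟨ m≡m%n+[m/n]*n a d ⟩
    a % d + a / d * d          ≤⟨ +-monoˡ-≤ (a / d * d) (<⇒≤ (m%n<n a d)) ⟩
    d + a / d * d
      -- The quotient is at least `s`, hence positive, so a remainder below `d` is at most
      -- `a / d * d`.
      ≤⟨ +-monoˡ-≤ (a / d * d) (≤-trans (≤-reflexive (sym (*-identityˡ d))) (*-monoˡ-≤ d (≤-trans 0<s s≤u))) ⟩
    a / d * d + a / d * d      ≡⟨ cong (a / d * d +_) (+-identityʳ (a / d * d)) ⟨
    2 * (a / d * d)            ∎)
    where
    instance
      _ = >-nonZero 0<d
    s≤u : s ≤ a / d
    s≤u = ≤-trans (≤-reflexive (sym (m*n/n≡m s d))) (/-monoˡ-≤ d sd≤a)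

  -- A fingerprint is coded as a constant vector; for uniformity 1 there are no picks to code.
  headOr∅ : ∀ {N j} → Vec (Subset N) j → Subset N
  headOr∅ []      = ∅
  headOr∅ (X ∷ _) = X

  headOr∅-replicate : ∀ {N} j {P : Subset N} → (j ≡ 0 → P ≡ ∅) → headOr∅ (Vec.replicate j P) ≡ P
  headOr∅-replicate zero    P≡∅ = sym (P≡∅ refl)
  headOr∅-replicate (suc j) _   = refl

  -- The theorem for `ε = 1 / q`, `B = b`, `γ = 1 / g` and `T = t`, without randomness and without
  -- denominators. The pair condition is asked for every `n` from `m₀` on, because the algorithm
  -- runs with `n` near `m / t`.
  containers : ∀ j b q → 0 < b → 0 < q → ∃₂ λ g t → 0 < g × 0 < t ×
    (∀ {N} (E : List (Subset N)) → Allˡ (λ h → ∣ h ∣ ≡ suc j) E →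
     ∀ m₀ m → 0 < m₀ → t * m₀ ≤ m → m < N →
     (∀ n r → m₀ ≤ n → n * r ≤ N → n * pairSum r E ≤ b * (length E * length E)) →
     ∃ λ (f : Vec (Subset N) j → Subset N) →
       (∀ 𝐅 → q * #within E (f 𝐅) ≤ length E) ×
       (∀ I → #within E I * (g * N ^ suc j) < length E * m ^ suc j →
        ∃₂ λ F 𝐅 → F ⊆ I × q * ∣ F ∣ ≤ m × All (_⊆ F) 𝐅 × I ⊆ F ∪ f 𝐅))
  containers j b q 0<b 0<q = g , t , 0<g , 0<t , λ {N} E sizes m₀ m 0<m₀ tm₀≤m m<N Δ≤ →
    -- `n` is about `m / t` and `r` about `N / n`, both rounded down; `t ≤ r` holds because
    -- `n * t ≤ m < N`.
    let n , m₀≤n , nt≤m , m≤2nt = quotient m t m₀ 0<t 0<m₀ (≤-trans (≤-reflexive (*-comm m₀ t)) tm₀≤m)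
        0<n = ≤-trans 0<m₀ m₀≤n
        r , t≤r , rn≤N , N≤2rn = quotient N n t 0<n 0<t
            (≤-trans (≤-reflexive (*-comm t n)) (≤-trans nt≤m (<⇒≤ m<N)))
        nr≤N = ≤-trans (≤-reflexive (*-comm n r)) rn≤N
        N≤2nr = ≤-trans N≤2rn (≤-reflexive (cong (2 *_) (*-comm r n)))
    in conclude E sizes m n r 0<n (≤-trans 0<t t≤r) nt≤m m≤2nt t≤r nr≤N N≤2nr (≤-trans (s≤s z≤n) m<N)
          (Δ≤ n r m₀≤n nr≤N)
    where
    -- `L` rounds suffice because `2 * c * N < L * N`. `t` is such that `n` exceptional points and
    -- `L * (j * n)` picks, times `q`, amount to at most `n * t ≤ m`; it also gives `c ≤ t ≤ r`. `g`
    -- collects the factors of `few`, with `(2 * t) ^ suc j` coming from `m ≤ 2 * (n * t)`.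
    c L t g : ℕ
    c = loss j (b * (q * q))
    L = suc (2 * c)
    t = L * (suc j * q)
    g = L * (q * c) * (2 * t) ^ suc j
    0<c : 0 < c
    0<c = ≤-trans (0<* {32} z<s (0<* 0<b (0<* 0<q 0<q))) (32B≤loss j (b * (q * q)))
    0<t : 0 < t
    0<t = 0<* {L} z<s (0<* {suc j} z<s 0<q)
    0<g : 0 < g
    0<g = 0<* (0<* {L} z<s (0<* 0<q 0<c)) (m^n>0 (2 * t) {{>-nonZero (0<* {2} z<s 0<t)}} (suc j))
    c≤t : c ≤ t
    c≤t = begin
      c          ≤⟨ m≤n*m c 2 ⟩
      2 * c      ≤⟨ n≤1+n (2 * c) ⟩
      L          ≡⟨ *-identityʳ L ⟨
      L * 1      ≤⟨ *-monoʳ-≤ L (0<* {suc j} z<s 0<q) ⟩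
      t          ∎

    module _ {N : ℕ} (E : List (Subset N)) (sizes : Allˡ (λ h → ∣ h ∣ ≡ suc j) E) (m n r : ℕ)
             (0<n : 0 < n) (0<r : 0 < r) (nt≤m : n * t ≤ m) (m≤2nt : m ≤ 2 * (n * t)) (t≤r : t ≤ r)
             (nr≤N : n * r ≤ N) (N≤2nr : N ≤ 2 * (n * r)) (0<N : 0 < N)
             (Δ≤ : n * pairSum r E ≤ b * (length E * length E)) where

      open Shrinking n r 0<n 0<r {N} j b q E

      conclude : ∃ λ (f : Vec (Subset N) j → Subset N) →
        (∀ 𝐅 → q * #within E (f 𝐅) ≤ length E) ×
        (∀ I → #within E I * (g * N ^ suc j) < length E * m ^ suc j →
         ∃₂ λ F 𝐅 → F ⊆ I × q * ∣ F ∣ ≤ m × All (_⊆ F) 𝐅 × I ⊆ F ∪ f 𝐅)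
      conclude = (λ 𝐅 → container (headOr∅ 𝐅)) , (λ 𝐅 → Shrunk.sparse (shrunk (headOr∅ 𝐅))) , λ I few-edges →
        let P   = fromList (proj₁ (shrink L I ⊤))
            P⊆I = fromList-⊆ (Shrunk.picked (shrunk I))
            F   = (I ─ container I) ∪ P
            𝐅   = Vec.replicate j P
            f𝐅≡ = trans (cong container (headOr∅-replicate j (no-picks I)))
                        (cong proj₂ (shrink-stable N≤2nr 0<b 0<q (≤-trans c≤t t≤r) sizes Δ≤ L ⊤ P⊆I
                            (tabulateˡ ∈-fromList)))
        in F , 𝐅 , ∪-least (p─q⊆p I (container I)) P⊆I , F-small I few-edges ,
              replicate⁺ j (q⊆p∪q (I ─ container I) P) ,
           subst (λ S → I ⊆ F ∪ S) (sym f𝐅≡) (covers I)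
        where
        container : Subset N → Subset N
        container X = proj₂ (shrink L X ⊤)
        shrunk : ∀ X → Shrunk L X ⊤ (proj₁ (shrink L X ⊤)) (container X)
        shrunk X = shrink-shrunk N≤2nr 0<b 0<q (≤-trans c≤t t≤r) sizes Δ≤ L X ⊤
          (≤-<-trans (≤-reflexive (cong (2 * c *_) (∣⊤∣≡n N))) (*-monoˡ-< N {{>-nonZero 0<N}} (n<1+n (2 * c))))
        no-picks : ∀ X → j ≡ 0 → fromList (proj₁ (shrink L X ⊤)) ≡ ∅
        no-picks X refl with proj₁ (shrink L X ⊤) | Shrunk.#picks (shrunk X)
        ... | []    | _    = refl
        ... | _ ∷ _ | few  = contradiction (≤-trans few (≤-reflexive (*-zeroʳ L))) n≮0
        ∪-least : ∀ {X Y Z : Subset N} → X ⊆ Z → Y ⊆ Z → X ∪ Y ⊆ Z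
        ∪-least {X} {Y} X⊆Z Y⊆Z v∈ with x∈p∪q⁻ X Y v∈
        ... | inj₁ v∈X = X⊆Z v∈X
        ... | inj₂ v∈Y = Y⊆Z v∈Y
        replicate⁺ : ∀ k {X Y : Subset N} → X ⊆ Y → All (_⊆ Y) (Vec.replicate k X)
        replicate⁺ zero    X⊆Y = []
        replicate⁺ (suc k) X⊆Y = X⊆Y ∷ replicate⁺ k X⊆Y
        covers : ∀ I → I ⊆ ((I ─ container I) ∪ fromList (proj₁ (shrink L I ⊤))) ∪ container I
        covers I {v} v∈I with v ∈? container I
        ... | yes v∈S = x∈p∪q⁺ (inj₂ v∈S)
        ... | no v∉S  = x∈p∪q⁺ (inj₁ (x∈p∪q⁺ (inj₁ (x∈p∧x∉q⇒x∈p─q v∈I v∉S))))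
        e : ℕ
        e = length E
        module _ (I : Subset N) (few-edges : #within E I * (g * N ^ suc j) < e * m ^ suc j) where
          w y : ℕ
          w = #within E I
          y = ∣ I ─ container I ∣
          0<e : 0 < e
          0<e = 0<*⁻ʳ (m ^ suc j) (≤-trans (s≤s z≤n) (≤-trans few-edges (≤-reflexive (*-comm e (m ^ suc j)))))
          ye≤ : y * e ≤ L * (q * (c * (r ^ suc j * n) * w))
          ye≤ = ≤-trans (Shrunk.few (shrunk I))
              (≤-reflexive (cong (λ x → x * e + L * (q * (c * (r ^ suc j * n) * w)))
            (trans (cong ∣_∣ (p─⊤≡⊥ I)) (∣⊥∣≡0 N))))
          0<N^ : 0 < N ^ suc j
          0<N^ = m^n>0 N {{>-nonZero 0<N}} (suc j)
          m^≤ : m ^ suc j ≤ (2 * t) ^ suc j * n ^ suc j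
          m^≤ = begin
            m ^ suc j                          ≤⟨ ^-monoˡ-≤ (suc j) m≤2nt ⟩
            (2 * (n * t)) ^ suc j              ≡⟨ cong (_^ suc j) (eq n t) ⟩
            (2 * t * n) ^ suc j                ≡⟨ ^-distribʳ-* (suc j) (2 * t) n ⟩
            (2 * t) ^ suc j * n ^ suc j        ∎
            where
            eq : ∀ n t → 2 * (n * t) ≡ 2 * t * n
            eq = solve-∀
          rn^≤ : r ^ suc j * n ^ suc j ≤ N ^ suc j
          rn^≤ = ≤-trans (≤-reflexive (sym (^-distribʳ-* (suc j) r n)))
              (^-monoˡ-≤ (suc j) (≤-trans (≤-reflexive (*-comm r n)) nr≤N))
          -- Insert the assumed upper bound on the number of edges inside `I` into `ye≤` and replace
          -- `m` by `2 * t * n`. Then `(r * n) ^ suc j ≤ N ^ suc j` cancels the power of `N`, and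
          -- the remaining constants are exactly `g`.
          y≤n : y ≤ n
          y≤n = cancelˡ (e * (g * N ^ suc j)) (0<* 0<e (0<* 0<g 0<N^)) (begin
            e * (g * N ^ suc j) * y
              ≡⟨ eq₁ e (g * N ^ suc j) y ⟩
            y * e * (g * N ^ suc j)
              ≤⟨ *-monoˡ-≤ (g * N ^ suc j) ye≤ ⟩
            L * (q * (c * (r ^ suc j * n) * w)) * (g * N ^ suc j)
              ≡⟨ eq₂ L q c (r ^ suc j) n w (g * N ^ suc j) ⟩
            L * (q * c) * r ^ suc j * n * (w * (g * N ^ suc j))
              ≤⟨ *-monoʳ-≤ (L * (q * c) * r ^ suc j * n) (<⇒≤ few-edges) ⟩
            L * (q * c) * r ^ suc j * n * (e * m ^ suc j)
              ≤⟨ *-monoʳ-≤ (L * (q * c) * r ^ suc j * n) (*-monoʳ-≤ e m^≤) ⟩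
            L * (q * c) * r ^ suc j * n * (e * ((2 * t) ^ suc j * n ^ suc j))
              ≡⟨ eq₃ (L * (q * c)) (r ^ suc j) n e ((2 * t) ^ suc j) (n ^ suc j) ⟩
            e * (L * (q * c) * (2 * t) ^ suc j * n) * (r ^ suc j * n ^ suc j)
              ≤⟨ *-monoʳ-≤ (e * (g * n)) rn^≤ ⟩
            e * (g * n) * N ^ suc j
              ≡⟨ eq₄ e g n (N ^ suc j) ⟩
            e * (g * N ^ suc j) * n ∎)
            where
            eq₁ : ∀ e g y → e * g * y ≡ y * e * g
            eq₁ = solve-∀
            eq₂ : ∀ L q c r n w g → L * (q * (c * (r * n) * w)) * g ≡ L * (q * c) * r * n * (w * g)
            eq₂ = solve-∀
            eq₃ : ∀ C r n e t ν → C * r * n * (e * (t * ν)) ≡ e * (C * t * n) * (r * ν)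
            eq₃ = solve-∀
            eq₄ : ∀ e g n N → e * (g * n) * N ≡ e * (g * N) * n
            eq₄ = solve-∀
          F-small : q * ∣ (I ─ container I) ∪ fromList (proj₁ (shrink L I ⊤)) ∣ ≤ m
          F-small = begin
            q * ∣ (I ─ container I) ∪ fromList (proj₁ (shrink L I ⊤)) ∣
              ≤⟨ *-monoʳ-≤ q (≤-trans (∣p∪q∣≤∣p∣+∣q∣ (I ─ container I) _)
                   (+-mono-≤ y≤n (≤-trans (∣fromList∣≤ (proj₁ (shrink L I ⊤))) (Shrunk.#picks (shrunk I))))) ⟩
            q * (n + L * (j * n))
              ≤⟨ *-monoʳ-≤ q (+-monoˡ-≤ (L * (j * n)) (m≤n*m n L)) ⟩
            q * (L * n + L * (j * n))
              ≡⟨ eq q L n j ⟩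
            n * t
              ≤⟨ nt≤m ⟩
            m ∎
            where
            eq : ∀ q L n j → q * (L * n + L * (j * n)) ≡ n * (L * (suc j * q))
            eq = solve-∀

-- Rational inequalities reduced to natural numbers.

module Fractions where

  import Data.Rational.Properties
  open import Algebra.Definitions.RawSemiring Data.Rational.Properties.+-*-rawSemiring using (_^_)
  open import Data.Fin.Subset using (Subset; ∣_∣; _∩_; _∪_)
  open import Data.Fin.Subset.Properties using (nonempty?; Empty-unique; ∣⊥∣≡0)
  open import Data.Integer.Base as ℤ using (+_)
  import Data.Integer.Properties as ℤ
  open import Data.List.Base using (List; []; _∷_; map; foldr; filter; length; cartesianProduct)
  open import Data.List.Membership.Propositional using () renaming (_∈_ to _∈ˡ_)
  open import Data.List.Membership.Propositional.Properties using (∈-cartesianProduct⁻)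
  open import Data.List.Relation.Unary.All as All using (All)
  open import Data.List.Relation.Unary.Any using (here; there)
  open import Data.Nat.Base as ℕ using (ℕ; zero; suc; NonZero; >-nonZero)
  import Data.Nat.Coprimality as Coprimality
  import Data.Nat.Properties as ℕ
  open import Data.Nat.Tactic.RingSolver using (solve-∀)
  open import Data.Product.Base using (_×_; _,_; proj₁; proj₂)
  open import Data.Rational.Base
    using (ℚ; mkℚ; 0ℚ; 1ℚ; _+_; _*_; _/_; _≤_; *≤*; Positive; NonNegative; toℚᵘ)
  open import Data.Rational.Properties
  open import Data.Rational.Solver using (module +-*-Solver)
  open import Data.Rational.Unnormalised.Base as ℚᵘ using (mkℚᵘ; *≡*)
  import Data.Rational.Unnormalised.Properties as ℚᵘ
  open import Relation.Binary.PropositionalEquality using (_≡_; refl; sym; trans; cong; cong₂; subst₂)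
  open import Relation.Nullary using (yes; no)
  open Containers using (∑; ∑-++; ∑-map; ^-distribʳ-*; ∣p∪q∣+∣p∩q∣; weight; W; load; pairSum)
  open +-*-Solver using (solve; _:=_; _:*_)

  ι : ℕ → ℚ
  ι a = + a / 1

  ι-normal : ∀ a → ι a ≡ mkℚ (+ a) 0 (Coprimality.sym (Coprimality.1-coprimeTo a))
  ι-normal a = normalize-coprime (Coprimality.sym (Coprimality.1-coprimeTo a))

  ι-mono : ∀ {a b} → a ℕ.≤ b → ι a ≤ ι b
  ι-mono {a} {b} a≤b = subst₂ _≤_ (sym (ι-normal a)) (sym (ι-normal b))
    (*≤* (ℤ.*-monoʳ-≤-nonNeg (+ 1) (ℤ.+≤+ a≤b)))

  ι-cancel : ∀ {a b} → ι a ≤ ι b → a ℕ.≤ b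
  ι-cancel {a} {b} ιa≤ιb = ℤ.drop‿+≤+ (ℤ.*-cancelʳ-≤-pos (+ a) (+ b) (+ 1)
    (drop-*≤* (subst₂ _≤_ (ι-normal a) (ι-normal b) ιa≤ιb)))

  ι-* : ∀ a b → ι (a ℕ.* b) ≡ ι a * ι b
  ι-* a b = trans (cong (_/ 1) (ℤ.pos-* a b)) (sym (cong₂ _*_ (ι-normal a) (ι-normal b)))

  ι-+ : ∀ a b → ι (a ℕ.+ b) ≡ ι a + ι b
  ι-+ a b = trans (cong (_/ 1) (sym (cong₂ ℤ._+_ (ℤ.*-identityʳ (+ a)) (ℤ.*-identityʳ (+ b)))))
    (sym (cong₂ _+_ (ι-normal a) (ι-normal b)))

  ι-positive : ∀ {a} → 0 ℕ.< a → Positive (ι a)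
  ι-positive {a} 0<a = normalize-pos a 1 {{_}} {{>-nonZero 0<a}}

  ι-nonNegative : ∀ a → NonNegative (ι a)
  ι-nonNegative a = normalize-nonNeg a 1

  -- The fraction `+ a / d` is stored in lowest terms, so the identity is checked among unnormalised
  -- fractions, where it is a cross-multiplication.
  /-ι : ∀ a d .{{_ : NonZero d}} → (+ a / d) * ι d ≡ ι a
  /-ι a (suc d) = toℚᵘ-injective (begin
    toℚᵘ ((+ a / suc d) * ι (suc d))              ≈⟨ toℚᵘ-homo-* (+ a / suc d) (ι (suc d)) ⟩
    toℚᵘ (+ a / suc d) ℚᵘ.* toℚᵘ (ι (suc d))
      ≈⟨ ℚᵘ.*-cong (toℚᵘ-fromℚᵘ (mkℚᵘ (+ a) d)) (toℚᵘ-fromℚᵘ (mkℚᵘ (+ suc d) 0)) ⟩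
    mkℚᵘ (+ a) d ℚᵘ.* mkℚᵘ (+ suc d) 0
      ≈⟨ *≡* (trans (ℤ.*-identityʳ _) (cong (λ x → + a ℤ.* + suc x) (sym (ℕ.*-identityʳ d)))) ⟩
    mkℚᵘ (+ a) 0                                  ≈⟨ toℚᵘ-fromℚᵘ (mkℚᵘ (+ a) 0) ⟨
    toℚᵘ (ι a)                                    ∎)
    where open ℚᵘ.≃-Reasoning

  interchange : ∀ a b c d → (a * b) * (c * d) ≡ (a * c) * (b * d)
  interchange = solve 4 (λ a b c d → (a :* b) :* (c :* d) := (a :* c) :* (b :* d)) refl

  ^-ι : ∀ {p a d} → p * ι d ≡ ι a → ∀ i → p ^ i * ι (d ℕ.^ i) ≡ ι (a ℕ.^ i)
  ^-ι {p} {a} {d} eq zero    = *-identityˡ (ι 1)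
  ^-ι {p} {a} {d} eq (suc i) = begin
    p * p ^ i * ι (d ℕ.* d ℕ.^ i)         ≡⟨ cong (p * p ^ i *_) (ι-* d (d ℕ.^ i)) ⟩
    p * p ^ i * (ι d * ι (d ℕ.^ i))       ≡⟨ interchange p (p ^ i) (ι d) (ι (d ℕ.^ i)) ⟩
    p * ι d * (p ^ i * ι (d ℕ.^ i))       ≡⟨ cong₂ _*_ eq (^-ι eq i) ⟩
    ι a * ι (a ℕ.^ i)                     ≡⟨ ι-* a (a ℕ.^ i) ⟨
    ι (a ℕ.* a ℕ.^ i)                     ∎
    where open Relation.Binary.PropositionalEquality.≡-Reasoning

  pairSum-cartesianProduct : ∀ r {N} (G H : List (Subset N)) →
    ∑ (cartesianProduct G H) (λ (g , h) → W r g h) ≡ ∑ G (load r H)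
  pairSum-cartesianProduct r []      H = refl
  pairSum-cartesianProduct r (g ∷ G) H = trans (∑-++ _ (map (g ,_) H) (cartesianProduct G H))
    (cong₂ ℕ._+_ (∑-map _ (g ,_) H) (pairSum-cartesianProduct r G H))

  -- For `i` at least 1, `n * r ^ i` is at most `N ^ i / n ^ (i - 1)`, hence at most
  -- `N ^ i / m₀ ^ (i - 1)`. For `i = 0` the weight vanishes.
  weight-scale : ∀ {n r m₀ N} → m₀ ℕ.≤ n → n ℕ.* r ℕ.≤ N → ∀ i u →
                 m₀ ℕ.^ (u ℕ.+ i) ℕ.* (n ℕ.* weight r i) ℕ.≤ m₀ ℕ.* (N ℕ.^ i ℕ.* m₀ ℕ.^ u)
  weight-scale {n} {r} {m₀} {N} m₀≤n nr≤N zero    u =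
    ℕ.≤-trans
        (ℕ.≤-reflexive (trans (cong (m₀ ℕ.^ (u ℕ.+ 0) ℕ.*_) (ℕ.*-zeroʳ n)) (ℕ.*-zeroʳ (m₀ ℕ.^ (u ℕ.+ 0)))))
            ℕ.z≤n
  weight-scale {n} {r} {m₀} {N} m₀≤n nr≤N (suc i) u = begin
    m₀ ℕ.^ (u ℕ.+ suc i) ℕ.* (n ℕ.* r ℕ.^ suc i)
      ≡⟨ cong (ℕ._* (n ℕ.* r ℕ.^ suc i)) (ℕ.^-distribˡ-+-* m₀ u (suc i)) ⟩
    m₀ ℕ.^ u ℕ.* (m₀ ℕ.* m₀ ℕ.^ i) ℕ.* (n ℕ.* r ℕ.^ suc i)
      ≤⟨ ℕ.*-monoˡ-≤ (n ℕ.* r ℕ.^ suc i) (ℕ.*-monoʳ-≤ (m₀ ℕ.^ u) (ℕ.*-monoʳ-≤ m₀ (ℕ.^-monoˡ-≤ i m₀≤n))) ⟩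
    m₀ ℕ.^ u ℕ.* (m₀ ℕ.* n ℕ.^ i) ℕ.* (n ℕ.* r ℕ.^ suc i)
      ≡⟨ eq (m₀ ℕ.^ u) m₀ (n ℕ.^ i) n (r ℕ.^ suc i) ⟩
    m₀ ℕ.* (n ℕ.^ suc i ℕ.* r ℕ.^ suc i ℕ.* m₀ ℕ.^ u)
      ≡⟨ cong (λ x → m₀ ℕ.* (x ℕ.* m₀ ℕ.^ u)) (^-distribʳ-* (suc i) n r) ⟨
    m₀ ℕ.* ((n ℕ.* r) ℕ.^ suc i ℕ.* m₀ ℕ.^ u)
      ≤⟨ ℕ.*-monoʳ-≤ m₀ (ℕ.*-monoˡ-≤ (m₀ ℕ.^ u) (ℕ.^-monoˡ-≤ (suc i) nr≤N)) ⟩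
    m₀ ℕ.* (N ℕ.^ suc i ℕ.* m₀ ℕ.^ u) ∎
    where
    open ℕ.≤-Reasoning
    eq : ∀ a b c d e → a ℕ.* (b ℕ.* c) ℕ.* (d ℕ.* e) ≡ b ℕ.* (d ℕ.* c ℕ.* e ℕ.* a)
    eq = solve-∀

  module _ {N : ℕ} (k n r m₀ : ℕ) (m₀≤n : m₀ ℕ.≤ n) (nr≤N : n ℕ.* r ℕ.≤ N) {p : ℚ} (p≡m₀/N : p * ι N ≡ ι m₀)
      where

    private
      Pair : Set
      Pair = Subset N × Subset N

      C : ℚ
      C = ι (m₀ ℕ.* N ℕ.^ (k ℕ.+ k))

      M : ℕ
      M = m₀ ℕ.^ (k ℕ.+ k)

      ∑-intersecting : List Pair → ℚ
      ∑-intersecting ps =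
          foldr _+_ 0ℚ (map (λ (e , e′) → p ^ ∣ e ∪ e′ ∣) (filter (λ (e , e′) → nonempty? (e ∩ e′)) ps))

    -- With `i = ∣ g ∩ h ∣` and `u = ∣ g ∪ h ∣` one has `u + i = 2k`, so multiplying `p ^ u` by
    -- `N ^ (2k)` gives `m₀ ^ u * N ^ i`. What remains is `weight-scale`.
    term-≤ : ∀ (g h : Subset N) → ∣ g ∣ ≡ k → ∣ h ∣ ≡ k → ι (M ℕ.* (n ℕ.* W r g h)) ≤ C * p ^ ∣ g ∪ h ∣
    term-≤ g h ∣g∣≡k ∣h∣≡k = begin
      ι (M ℕ.* (n ℕ.* W r g h))
        ≡⟨ cong (λ x → ι (m₀ ℕ.^ x ℕ.* (n ℕ.* W r g h))) (sym u+i≡2k) ⟩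
      ι (m₀ ℕ.^ (u ℕ.+ i) ℕ.* (n ℕ.* weight r i))     ≤⟨ ι-mono (weight-scale m₀≤n nr≤N i u) ⟩
      ι (m₀ ℕ.* (N ℕ.^ i ℕ.* m₀ ℕ.^ u))               ≡⟨ cong ι (ℕ.*-assoc m₀ (N ℕ.^ i) (m₀ ℕ.^ u)) ⟨
      ι (m₀ ℕ.* N ℕ.^ i ℕ.* m₀ ℕ.^ u)                 ≡⟨ ι-* (m₀ ℕ.* N ℕ.^ i) (m₀ ℕ.^ u) ⟩
      ι (m₀ ℕ.* N ℕ.^ i) * ι (m₀ ℕ.^ u)
        ≡⟨ cong (ι (m₀ ℕ.* N ℕ.^ i) *_) (trans (sym (^-ι p≡m₀/N u)) (*-comm (p ^ u) (ι (N ℕ.^ u)))) ⟩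
      ι (m₀ ℕ.* N ℕ.^ i) * (ι (N ℕ.^ u) * p ^ u)      ≡⟨ *-assoc (ι (m₀ ℕ.* N ℕ.^ i)) (ι (N ℕ.^ u)) (p ^ u) ⟨
      ι (m₀ ℕ.* N ℕ.^ i) * ι (N ℕ.^ u) * p ^ u        ≡⟨ cong (_* p ^ u) (ι-* (m₀ ℕ.* N ℕ.^ i) (N ℕ.^ u)) ⟨
      ι (m₀ ℕ.* N ℕ.^ i ℕ.* N ℕ.^ u) * p ^ u
        ≡⟨ cong (λ x → ι x * p ^ u) (trans (ℕ.*-assoc m₀ (N ℕ.^ i) (N ℕ.^ u)) (cong (m₀ ℕ.*_) N^)) ⟩
      C * p ^ u                                       ∎
      where
      open ≤-Reasoning
      i u : ℕ
      i = ∣ g ∩ h ∣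
      u = ∣ g ∪ h ∣
      u+i≡2k : u ℕ.+ i ≡ k ℕ.+ k
      u+i≡2k = trans (∣p∪q∣+∣p∩q∣ g h) (cong₂ ℕ._+_ ∣g∣≡k ∣h∣≡k)
      N^ : N ℕ.^ i ℕ.* N ℕ.^ u ≡ N ℕ.^ (k ℕ.+ k)
      N^ = trans (ℕ.*-comm (N ℕ.^ i) (N ℕ.^ u)) (trans (sym (ℕ.^-distribˡ-+-* N u i)) (cong (N ℕ.^_) u+i≡2k))

    pairs-≤ : ∀ (ps : List Pair) → (∀ {g h : Subset N} → (g , h) ∈ˡ ps → ∣ g ∣ ≡ k × ∣ h ∣ ≡ k) →
              ι (M ℕ.* (n ℕ.* ∑ ps (λ (g , h) → W r g h))) ≤ C * ∑-intersecting ps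
    pairs-≤ [] sizes =
        ≤-reflexive (trans (cong ι (trans (cong (M ℕ.*_) (ℕ.*-zeroʳ n)) (ℕ.*-zeroʳ M))) (sym (*-zeroʳ C)))
    pairs-≤ ((g , h) ∷ ps) sizes with nonempty? (g ∩ h)
    ... | yes _ = begin
      ι (M ℕ.* (n ℕ.* (W r g h ℕ.+ s)))                         ≡⟨ cong ι (eq M n (W r g h) s) ⟩
      ι (M ℕ.* (n ℕ.* W r g h) ℕ.+ M ℕ.* (n ℕ.* s))
        ≡⟨ ι-+ (M ℕ.* (n ℕ.* W r g h)) (M ℕ.* (n ℕ.* s)) ⟩
      ι (M ℕ.* (n ℕ.* W r g h)) + ι (M ℕ.* (n ℕ.* s))
        ≤⟨ +-mono-≤ (term-≤ g h (proj₁ gh) (proj₂ gh)) (pairs-≤ ps (λ gh∈ → sizes (there gh∈))) ⟩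
      C * p ^ ∣ g ∪ h ∣ + C * ∑-intersecting ps
          ≡⟨ *-distribˡ-+ C (p ^ ∣ g ∪ h ∣) (∑-intersecting ps) ⟨
      C * (p ^ ∣ g ∪ h ∣ + ∑-intersecting ps)                   ∎
      where
      open ≤-Reasoning
      s = ∑ ps (λ (g , h) → W r g h)
      gh = sizes (here refl)
      eq : ∀ M n w s → M ℕ.* (n ℕ.* (w ℕ.+ s)) ≡ M ℕ.* (n ℕ.* w) ℕ.+ M ℕ.* (n ℕ.* s)
      eq = solve-∀
    -- A disjoint pair has weight 0, which matches its absence from the filtered list.
    ... | no empty = ≤-trans
      (≤-reflexive (cong (λ x → ι (M ℕ.* (n ℕ.* (weight r x ℕ.+ ∑ ps (λ (g , h) → W r g h)))))
        (trans (cong ∣_∣ (Empty-unique {p = g ∩ h} empty)) (∣⊥∣≡0 N))))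
      (pairs-≤ ps (λ gh∈ → sizes (there gh∈)))

    -- Passing from m₀ to n loses nothing, since intersecting edges meet in at least one vertex.
    pairSum-≤ : ∀ b (E : List (Subset N)) {v} → 0 ℕ.< m₀ → All (λ h → ∣ h ∣ ≡ k) E → v * ι m₀ ≡ ι 1 →
                ∑-intersecting (cartesianProduct E E) ≤ ι b * ((ι (length E) * p ^ k) ^ 2 * v) →
                n ℕ.* pairSum r E ℕ.≤ b ℕ.* (length E ℕ.* length E)
    pairSum-≤ b E {v} 0<m₀ sizes v≡1/m₀ Δ≤ =
        ℕ.*-cancelˡ-≤ M {{ℕ.m^n≢0 m₀ (k ℕ.+ k) {{>-nonZero 0<m₀}}}} (ι-cancel (begin
      ι (M ℕ.* (n ℕ.* pairSum r E))
        ≡⟨ cong (λ x → ι (M ℕ.* (n ℕ.* x))) (pairSum-cartesianProduct r E E) ⟨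
      ι (M ℕ.* (n ℕ.* ∑ (cartesianProduct E E) (λ (g , h) → W r g h)))
        ≤⟨ pairs-≤ (cartesianProduct E E) (λ {g} {h} gh∈ →
             let g∈ , h∈ = ∈-cartesianProduct⁻ E E {g , h} gh∈
             in All.lookup sizes g∈ , All.lookup sizes h∈) ⟩
      C * ∑-intersecting (cartesianProduct E E)
        ≤⟨ *-monoˡ-≤-nonNeg C {{ι-nonNegative (m₀ ℕ.* N ℕ.^ (k ℕ.+ k))}} Δ≤ ⟩
      C * (ι b * ((ι e * p ^ k) ^ 2 * v))
        ≡⟨ cong (_* (ι b * ((ι e * p ^ k) ^ 2 * v))) (trans (ι-* m₀ (N ℕ.^ (k ℕ.+ k)))
             (cong (ι m₀ *_) (trans (cong ι (ℕ.^-distribˡ-+-* N k k)) (ι-* (N ℕ.^ k) (N ℕ.^ k))))) ⟩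
      ι m₀ * (ι (N ℕ.^ k) * ι (N ℕ.^ k)) * (ι b * ((ι e * p ^ k) ^ 2 * v))
        -- The square unfolds to `x * (x * 1ℚ)`; the final `1ℚ` accounts for this trailing unit.
        ≡⟨ rearrange (ι m₀) (ι (N ℕ.^ k)) (ι b) (ι e) (p ^ k) v 1ℚ ⟩
      (ι b * (ι e * ι e)) * ((p ^ k * ι (N ℕ.^ k)) * (p ^ k * ι (N ℕ.^ k))) * (v * ι m₀) * 1ℚ
        ≡⟨ trans (*-identityʳ _)
          (trans (cong₂ _*_ (cong₂ _*_ (sym ιbee) (trans (cong₂ _*_ (^-ι p≡m₀/N k) (^-ι p≡m₀/N k)) (sym ιM)))
              v≡1/m₀) (*-identityʳ _)) ⟩
      ι (b ℕ.* (e ℕ.* e)) * ι M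
        ≡⟨ trans (*-comm (ι (b ℕ.* (e ℕ.* e))) (ι M)) (sym (ι-* M (b ℕ.* (e ℕ.* e)))) ⟩
      ι (M ℕ.* (b ℕ.* (e ℕ.* e))) ∎))
      where
      open ≤-Reasoning
      e = length E
      ιbee : ι (b ℕ.* (e ℕ.* e)) ≡ ι b * (ι e * ι e)
      ιbee = trans (ι-* b (e ℕ.* e)) (cong (ι b *_) (ι-* e e))
      ιM : ι M ≡ ι (m₀ ℕ.^ k) * ι (m₀ ℕ.^ k)
      ιM = trans (cong ι (ℕ.^-distribˡ-+-* m₀ k k)) (ι-* (m₀ ℕ.^ k) (m₀ ℕ.^ k))
      rearrange : ∀ m n b e p v o → m * (n * n) * (b * ((e * p) * ((e * p) * o) * v))
                  ≡ (b * (e * e)) * ((p * n) * (p * n)) * (v * m) * o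
      rearrange = solve 7 (λ m n b e p v o → m :* (n :* n) :* (b :* ((e :* p) :* ((e :* p) :* o) :* v))
                  := (b :* (e :* e)) :* ((p :* n) :* (p :* n)) :* (v :* m) :* o) refl

  -- Turns the count inequality into (P1): `u` is `γ = 1 / g` and `p` is `m / N`.
  edges-≤ : ∀ k {N p m u} e w g → 0 ℕ.< N → 0 ℕ.< g → p * ι N ≡ ι m → u * ι g ≡ ι 1 →
            e ℕ.* m ℕ.^ k ℕ.≤ w ℕ.* (g ℕ.* N ℕ.^ k) → u * (ι e * p ^ k) ≤ ι w
  edges-≤ k {N} {p} {m} {u} e w g 0<N 0<g p≡m/N u≡1/g le = *-cancelʳ-≤-pos (ι (g ℕ.* N ℕ.^ k))
    {{ι-positive (ℕ.*-mono-< 0<g (ℕ.m^n>0 N {{>-nonZero 0<N}} k))}} (begin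
      u * (ι e * p ^ k) * ι (g ℕ.* N ℕ.^ k)               ≡⟨ cong (u * (ι e * p ^ k) *_) (ι-* g (N ℕ.^ k)) ⟩
      u * (ι e * p ^ k) * (ι g * ι (N ℕ.^ k))             ≡⟨ interchange u (ι e * p ^ k) (ι g) (ι (N ℕ.^ k)) ⟩
      u * ι g * (ι e * p ^ k * ι (N ℕ.^ k))
        ≡⟨ cong₂ _*_ u≡1/g (trans (*-assoc (ι e) (p ^ k) _) (cong (ι e *_) (^-ι p≡m/N k))) ⟩
      ι 1 * (ι e * ι (m ℕ.^ k))                           ≡⟨ trans (*-identityˡ _) (sym (ι-* e (m ℕ.^ k))) ⟩
      ι (e ℕ.* m ℕ.^ k)                                   ≤⟨ ι-mono le ⟩
      ι (w ℕ.* (g ℕ.* N ℕ.^ k))                           ≡⟨ ι-* w (g ℕ.* N ℕ.^ k) ⟩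
      ι w * ι (g ℕ.* N ℕ.^ k)                             ∎)
    where open ≤-Reasoning

open import Data.Bool.Base using (true; false)
open import Data.Empty using (⊥-elim)
open import Data.Fin.Subset using (Subset; _⊆_; _∪_; ∣_∣)
open import Data.Fin.Subset.Properties using (x∈p∪q⁺; x∈p∪q⁻)
import Data.Integer.Base as ℤ
open import Data.Integer.Base using (+_)
import Data.Integer.Properties as ℤ
open import Data.List.Base using (List; []; _∷_; length; filterᵇ)
open import Data.Nat.Base as ℕ using (ℕ; NonZero; pred; zero; suc)
import Data.Nat.Properties as ℕ
open import Data.Product.Base using (∃; ∃₂; _×_; _,_; proj₁; proj₂)
open import Data.Rational.Base as ℚ using (ℚ; mkℚ; 0ℚ; 1ℚ)
import Data.Rational.Properties as ℚ
open import Data.Rational.Solver using (module +-*-Solver)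
open import Data.Sum.Base using (_⊎_; inj₁; inj₂)
open import Data.Vec.Base using (Vec)
open import Data.Vec.Relation.Unary.All as All using (All)
open import Relation.Binary.PropositionalEquality using (_≡_; refl; sym; trans; cong; subst; subst₂)
open import Relation.Nullary using (Dec; yes; no; contradiction)
open import Defs
open Containers using (containers; ⊆-between)
open Fractions
  using (ι; ι-normal; ι-mono; ι-cancel; ι-*; ι-+; ι-positive; ι-nonNegative; /-ι; pairSum-≤; edges-≤)

-- Real numbers

-- Otherwise a rational strictly between `q` and `p` yields a tolerance that violates the
-- assumption.
≤-limit : ∀ {p q} → (∀ δ → 0ℚ ℚ.< δ → p ℚ.≤ q ℚ.+ δ) → p ℚ.≤ q
≤-limit {p} {q} p≤q+δ with p ℚ.≤? q
... | yes p≤q = p≤q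
... | no p≰q  = let s , q<s , s<p = ℚ.<-dense (ℚ.≰⇒> p≰q) in
  contradiction (ℚ.<-≤-trans s<p (ℚ.≤-trans (p≤q+δ (s ℚ.- q) (0<s-q q<s)) (ℚ.≤-reflexive (cancel q s))))
      (ℚ.<-irrefl refl)
  where
  open +-*-Solver
  cancel : ∀ q s → q ℚ.+ (s ℚ.- q) ≡ s
  cancel = solve 2 (λ q s → q :+ (s :- q) := s) refl
  0<s-q : ∀ {s} → q ℚ.< s → 0ℚ ℚ.< s ℚ.- q
  0<s-q {s} q<s = subst (ℚ._< s ℚ.- q) (ℚ.+-inverseʳ q) (ℚ.+-monoˡ-< (ℚ.- q) q<s)

p≤p+δ : ∀ p {δ} → 0ℚ ℚ.< δ → p ℚ.≤ p ℚ.+ δ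
p≤p+δ p 0<δ = subst (ℚ._≤ p ℚ.+ _) (ℚ.+-identityʳ p) (ℚ.+-monoʳ-≤ p (ℚ.<⇒≤ 0<δ))

≤-eventually : ∀ x y M → (∀ i → M ℕ.≤ i → seq x i ℚ.≤ seq y i) → x ≤ y
≤-eventually x y M x≤y δ 0<δ = M , λ i M≤i → ℚ.≤-trans (x≤y i M≤i) (p≤p+δ (seq y i) 0<δ)

fromℚ-cancel-≤ : ∀ {p q} → fromℚ p ≤ fromℚ q → p ℚ.≤ q
fromℚ-cancel-≤ p≤q = ≤-limit λ δ 0<δ → let M , h = p≤q δ 0<δ in h M ℕ.≤-refl

0<fromℚ : ∀ {p} → 0ℚ ℚ.< p → 0ℝ < fromℚ p
0<fromℚ {p} 0<p = p , 0<p , 0 , λ _ _ → ℚ.≤-reflexive (ℚ.+-identityˡ p)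

-- Allows `ε` to be replaced by `1 / q`. The number `q` is the denominator of a positive rational
-- below `ε`, whose numerator is at least 1.
reciprocal-≤ : ∀ ε → 0ℝ < ε → ∃ λ q → 0 ℕ.< q × ∃ λ M → ∀ i → M ℕ.≤ i → 1ℚ ℚ.≤ ι q ℚ.* seq ε i
reciprocal-≤ ε (δ , 0<δ , M , δ≤ε) =
  ℚ.↧ₙ δ , ℕ.s≤s ℕ.z≤n , M , λ i M≤i → ℚ.≤-trans (1≤denominator*p δ 0<δ)
    (ℚ.*-monoˡ-≤-nonNeg (ι (ℚ.↧ₙ δ)) {{ι-nonNegative (ℚ.↧ₙ δ)}}
        (subst (ℚ._≤ seq ε i) (ℚ.+-identityˡ δ) (δ≤ε i M≤i)))
  where
  1≤denominator*p : ∀ p → 0ℚ ℚ.< p → 1ℚ ℚ.≤ ι (ℚ.↧ₙ p) ℚ.* p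
  1≤denominator*p p 0<p with ℚ.↥ p in eq | ℚ.drop-*<* 0<p
  ... | + zero    | ℤ.+<+ ()
  ... | + (suc a) | _ = ℚ.≤-trans (ι-mono {1} {suc a} (ℕ.s≤s ℕ.z≤n))
        (ℚ.≤-reflexive (trans (sym (/-ι (suc a) (ℚ.↧ₙ p)))
          (trans (cong (ℚ._* ι (ℚ.↧ₙ p)) (trans (cong (λ z → z ℚ./ ℚ.↧ₙ p) (sym eq)) (ℚ.↥p/↧p≡p p)))
              (ℚ.*-comm p (ι (ℚ.↧ₙ p))))))
  ... | ℤ.-[1+ a ] | ()

≤-scale : ∀ {q x a c} → 0 ℕ.< q → 1ℚ ℚ.≤ ι q ℚ.* x → q ℕ.* a ℕ.≤ c → ι a ℚ.≤ x ℚ.* ι c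
≤-scale {q} {x} {a} {c} 0<q 1≤qx qa≤c = ℚ.*-cancelˡ-≤-pos (ι q) {{ι-positive 0<q}} (begin
  ι q ℚ.* ι a             ≡⟨ ι-* q a ⟨
  ι (q ℕ.* a)             ≤⟨ ι-mono qa≤c ⟩
  ι c                     ≡⟨ ℚ.*-identityˡ (ι c) ⟨
  1ℚ ℚ.* ι c              ≤⟨ ℚ.*-monoʳ-≤-nonNeg (ι c) {{ι-nonNegative c}} 1≤qx ⟩
  ι q ℚ.* x ℚ.* ι c       ≡⟨ ℚ.*-assoc (ι q) x (ι c) ⟩
  ι q ℚ.* (x ℚ.* ι c)     ∎)
  where open ℚ.≤-Reasoning

≤-natural : ∀ p → ∃ λ b → 0 ℕ.< b × p ℚ.≤ ι b
≤-natural p@(mkℚ (+ a) d c) = suc a , ℕ.s≤s ℕ.z≤n ,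
  ℚ.≤-trans (subst (p ℚ.≤_) (sym (ι-normal a)) (ℚ.*≤* (ℤ.*-monoˡ-≤-nonNeg (+ a) (ℤ.+≤+ (ℕ.s≤s ℕ.z≤n)))))
    (ι-mono (ℕ.n≤1+n a))
≤-natural p@(mkℚ ℤ.-[1+ a ] d c) = 1 , ℕ.s≤s ℕ.z≤n , ℚ.≤-trans (ℚ.nonPositive⁻¹ p) (ℚ.nonNegative⁻¹ (ι 1))

bounded-by-natural : ∀ x → ∃ λ b → 0 ℕ.< b × ∃ λ M → ∀ i → M ℕ.≤ i → seq x i ℚ.≤ ι b
bounded-by-natural x =
  let M , close = cauchy x 1ℚ (ℚ.positive⁻¹ 1ℚ)
      b , 0<b , ≤b = ≤-natural (1ℚ ℚ.+ seq x M)
  in b , 0<b , M , λ i M≤i → ℚ.≤-trans (begin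
       seq x i                                 ≡⟨ split (seq x i) (seq x M) ⟩
       (seq x i ℚ.- seq x M) ℚ.+ seq x M
         ≤⟨ ℚ.+-monoˡ-≤ (seq x M) (ℚ.≤-trans (p≤∣p∣ (seq x i ℚ.- seq x M)) (ℚ.<⇒≤ (close i M M≤i ℕ.≤-refl))) ⟩
       1ℚ ℚ.+ seq x M                          ∎) ≤b
  where
  open ℚ.≤-Reasoning
  open +-*-Solver
  split : ∀ p q → p ≡ (p ℚ.- q) ℚ.+ q
  split = solve 2 (λ p q → p := (p :- q) :+ q) refl
  p≤∣p∣ : ∀ p → p ℚ.≤ ℚ.∣ p ∣
  p≤∣p∣ p with ℚ.≤-total 0ℚ p
  ... | inj₁ 0≤p = ℚ.≤-reflexive (sym (ℚ.0≤p⇒∣p∣≡p 0≤p))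
  ... | inj₂ p≤0 = ℚ.≤-trans p≤0 (ℚ.0≤∣p∣ p)

fromℚ-*-cancel-≤ : ∀ {x b M p y} → (∀ i → M ℕ.≤ i → seq x i ℚ.≤ ι b) → 0ℚ ℚ.≤ y →
                   fromℚ p ≤ x * fromℚ y → p ℚ.≤ ι b ℚ.* y
fromℚ-*-cancel-≤ {M = M} {y = y} x≤b 0≤y p≤xy = ≤-limit λ δ 0<δ →
  let M′ , h = p≤xy δ 0<δ
      i = M ℕ.⊔ M′
  in ℚ.≤-trans (h i (ℕ.m≤n⊔m M M′))
       (ℚ.+-monoˡ-≤ δ (ℚ.*-monoʳ-≤-nonNeg y {{ℚ.nonNegative 0≤y}} (x≤b i (ℕ.m≤m⊔n M M′))))

^-nonNeg : ∀ ε m {i} → 0ℚ ℚ.≤ seq ε i → 0ℚ ℚ.≤ seq (ε ^ m) i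
^-nonNeg ε zero    0≤ε = ℚ.nonNegative⁻¹ 1ℚ
^-nonNeg ε (suc m) {i} 0≤ε = ℚ.nonNegative⁻¹ _
  {{ℚ.nonNeg*nonNeg⇒nonNeg (seq ε i) {{ℚ.nonNegative 0≤ε}} (seq (ε ^ m) i)
      {{ℚ.nonNegative (^-nonNeg ε m 0≤ε)}}}}

1≤^ : ∀ ε m {i} → 1ℚ ℚ.≤ seq ε i → 1ℚ ℚ.≤ seq (ε ^ m) i
1≤^ ε zero    1≤ε = ℚ.≤-refl
1≤^ ε (suc m) {i} 1≤ε = begin
  1ℚ                             ≡⟨ ℚ.*-identityˡ 1ℚ ⟨
  1ℚ ℚ.* 1ℚ                      ≤⟨ ℚ.*-monoˡ-≤-nonNeg 1ℚ (1≤^ ε m 1≤ε) ⟩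
  1ℚ ℚ.* seq (ε ^ m) i           ≤⟨ ℚ.*-monoʳ-≤-nonNeg (seq (ε ^ m) i)
                                      {{ℚ.nonNegative (ℚ.≤-trans (ℚ.nonNegative⁻¹ 1ℚ) (1≤^ ε m 1≤ε))}} 1≤ε ⟩
  seq ε i ℚ.* seq (ε ^ m) i      ∎
  where open ℚ.≤-Reasoning

1-x≤ : ∀ {x y} → y ℚ.≤ x → 1ℚ ℚ.- x ℚ.≤ 1ℚ ℚ.- y
1-x≤ y≤x = ℚ.+-monoʳ-≤ 1ℚ (ℚ.neg-antimono-≤ y≤x)

-- Certain events and trivial probability bounds.

filterᵇ-true : {A : Set} (xs : List A) → length (filterᵇ (λ _ → true) xs) ≡ length xs
filterᵇ-true []       = refl
filterᵇ-true (x ∷ xs) = cong suc (filterᵇ-true xs)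

-- The whole sample space serves as the event, and `1 - ε ^ m` is at most 1 because `ε` is
-- eventually nonnegative.
surely : ∀ ε m {N M} {P : Subset N → Set} → (∀ i → M ℕ.≤ i → 0ℚ ℚ.≤ seq ε i) → (∀ I → ∣ I ∣ ≡ m → P I) →
         WithProbabilityAtLeast (1ℝ - ε ^ m) m P
surely ε m {N} {M} 0≤ε P = (λ _ → true) , (λ I ∣I∣≡m _ → P I ∣I∣≡m) ,
  ≤-eventually ((1ℝ - ε ^ m) * fromℕ Ω) (fromℕ (length (filterᵇ (λ _ → true) (subsetsOfSize N m)))) M λ i M≤i →
      begin
  (1ℚ ℚ.- seq (ε ^ m) i) ℚ.* ι Ω
    ≤⟨ ℚ.*-monoʳ-≤-nonNeg (ι Ω) {{ι-nonNegative Ω}} (1-x≤ (^-nonNeg ε m (0≤ε i M≤i))) ⟩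
  1ℚ ℚ.* ι Ω                           ≡⟨ ℚ.*-identityˡ (ι Ω) ⟩
  ι Ω                                  ≡⟨ cong ι (filterᵇ-true (subsetsOfSize N m)) ⟨
  ι (length (filterᵇ (λ _ → true) (subsetsOfSize N m))) ∎
  where
  open ℚ.≤-Reasoning
  Ω = length (subsetsOfSize N m)

-- For `ε` at least 1 the required probability is at most 0, so the empty event suffices.
vacuously : ∀ ε m {N M} {P : Subset N → Set} → (∀ i → M ℕ.≤ i → 1ℚ ℚ.≤ seq ε i) →
            WithProbabilityAtLeast (1ℝ - ε ^ m) m P
vacuously ε m {N} {M} 1≤ε = (λ _ → false) , (λ _ _ ()) ,
  ≤-eventually ((1ℝ - ε ^ m) * fromℕ Ω) (fromℕ (length (filterᵇ (λ _ → false) (subsetsOfSize N m)))) M λ i M≤i →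
      begin
  (1ℚ ℚ.- seq (ε ^ m) i) ℚ.* ι Ω
    ≤⟨ ℚ.*-monoʳ-≤-nonNeg (ι Ω) {{ι-nonNegative Ω}} (1-x≤ (1≤^ ε m (1≤ε i M≤i))) ⟩
  0ℚ ℚ.* ι Ω                           ≡⟨ ℚ.*-zeroˡ (ι Ω) ⟩
  0ℚ
    ≤⟨ ℚ.nonNegative⁻¹ _ {{ι-nonNegative (length (filterᵇ (λ _ → false) (subsetsOfSize N m)))}} ⟩
  ι (length (filterᵇ (λ _ → false) (subsetsOfSize N m))) ∎
  where
  open ℚ.≤-Reasoning
  Ω = length (subsetsOfSize N m)

1≤ε-eventually : ∀ {ε m n} → 0 ℕ.< m → m ℕ.< n → IsFloor (ε * fromℕ m) n →
                 ∃ λ M → ∀ i → M ℕ.≤ i → 1ℚ ℚ.≤ seq ε i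
-- Tolerance 1 in the inequality `n ≤ ε m` is enough: by integrality `n - 1` is still at least `m`.
1≤ε-eventually {ε} {m} {n} 0<m m<n (n≤εm , _) = let M , h = n≤εm 1ℚ (ℚ.positive⁻¹ 1ℚ) in M , λ i M≤i →
  ℚ.*-cancelʳ-≤-pos (ι m) {{ι-positive 0<m}} (begin
    1ℚ ℚ.* ι m             ≡⟨ ℚ.*-identityˡ (ι m) ⟩
    ι m                    ≤⟨ +-cancelʳ-≤ (begin
      ι m ℚ.+ 1ℚ                   ≡⟨ ι-+ m 1 ⟨
      ι (m ℕ.+ 1)                  ≤⟨ ι-mono (ℕ.≤-trans (ℕ.≤-reflexive (ℕ.+-comm m 1)) m<n) ⟩
      ι n                          ≤⟨ h i M≤i ⟩
      seq ε i ℚ.* ι m ℚ.+ 1ℚ       ∎) ⟩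
    seq ε i ℚ.* ι m        ∎)
  where
  open ℚ.≤-Reasoning
  open +-*-Solver
  undo : ∀ p r → p ≡ p ℚ.+ r ℚ.+ ℚ.- r
  undo = solve 2 (λ p r → p := p :+ r :+ :- r) refl
  +-cancelʳ-≤ : ∀ {p q r} → p ℚ.+ r ℚ.≤ q ℚ.+ r → p ℚ.≤ q
  +-cancelʳ-≤ {p} {q} {r} le = subst₂ ℚ._≤_ (sym (undo p r)) (sym (undo q r)) (ℚ.+-monoˡ-≤ (ℚ.- r) le)

-- `s` is at most `m / q`, hence at most `ε m`, which is below `n + 1`; integrality gives the claim.
≤-floor : ∀ {ε q M m n s} → 0 ℕ.< q → (∀ i → M ℕ.≤ i → 1ℚ ℚ.≤ ι q ℚ.* seq ε i) → q ℕ.* s ℕ.≤ m →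
          IsFloor (ε * fromℕ m) n → s ℕ.≤ n
≤-floor {M = M} {m} {n} {s} 0<q 1≤qε qs≤m (_ , δ , 0<δ , M′ , εm+δ≤) =
  let i = M ℕ.⊔ M′ in
  ℕ.≤-pred (ℕ.≰⇒> λ n<s → ℚ.<-irrefl refl (begin-strict
    ι (suc n)                  ≤⟨ ι-mono n<s ⟩
    ι s                        ≤⟨ ≤-scale 0<q (1≤qε i (ℕ.m≤m⊔n M M′)) qs≤m ⟩
    _                          <⟨ p<p+δ _ ⟩
    _                          ≤⟨ εm+δ≤ i (ℕ.m≤n⊔m M M′) ⟩
    ι (suc n)                  ∎))
  where
  open ℚ.≤-Reasoning
  p<p+δ : ∀ p → p ℚ.< p ℚ.+ δ
  p<p+δ p = subst (ℚ._< p ℚ.+ δ) (ℚ.+-identityʳ p) (ℚ.+-monoʳ-< p 0<δ)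

-- Deduction of the theorem for real constants.

μ-square-nonNeg : ∀ {k N} (H : Hypergraph k N) .{{_ : NonZero N}} m₀ .{{_ : NonZero m₀}} →
                  0ℚ ℚ.≤ μ H m₀ ^ℚ 2 ℚ.* (+ 1 ℚ./ m₀)
μ-square-nonNeg {k} {N} H m₀ = ℚ.nonNegative⁻¹ _ {{ℚ.nonNeg*nonNeg⇒nonNeg (μ H m₀ ^ℚ 2)
    {{ℚ.nonNeg*nonNeg⇒nonNeg (μ H m₀) {{μ≥0}} (μ H m₀ ℚ.* 1ℚ) {{ℚ.nonNeg*nonNeg⇒nonNeg (μ H m₀) {{μ≥0}} 1ℚ}}}}
    (+ 1 ℚ./ m₀) {{ℚ.normalize-nonNeg 1 m₀}}}}
  where
  power≥0 : ∀ i → ℚ.NonNegative ((+ m₀ ℚ./ N) ^ℚ i)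
  power≥0 zero    = _
  power≥0 (suc i) = ℚ.nonNeg*nonNeg⇒nonNeg (+ m₀ ℚ./ N) {{ℚ.normalize-nonNeg m₀ N}} ((+ m₀ ℚ./ N) ^ℚ i)
      {{power≥0 i}}
  μ≥0 : ℚ.NonNegative (μ H m₀)
  μ≥0 = ℚ.nonNeg*nonNeg⇒nonNeg (ι (#edges H)) {{ι-nonNegative (#edges H)}} ((+ m₀ ℚ./ N) ^ℚ k) {{power≥0 k}}

theorem1p1 : ∀ (k : ℕ) .{{_ : NonZero k}} (ε B : ℝ) → 0ℝ < ε → 0ℝ < B →
    ∃₂ λ (γ T : ℝ) → 0ℝ < γ × 0ℝ < T ×
    (∀ (N : ℕ) .{{_ : NonZero N}} (H : Hypergraph k N)
    (m₀ : ℕ) .{{_ : NonZero m₀}} → m₀ ℕ.< N →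
    fromℚ (Δ H m₀) ≤ B * fromℚ (μ H m₀ ^ℚ 2 ℚ.* (+ 1 ℚ./ m₀)) →
    ∀ (m : ℕ) → T * fromℕ m₀ ≤ fromℕ m → m ℕ.< N →
    ∀ (⌊εm⌋ : ℕ) → IsFloor (ε * fromℕ m) ⌊εm⌋ →
    ∃ λ (f : Vec (Subset N) (pred k) → 𝓘 H ε) →
    WithProbabilityAtLeast (1ℝ - ε ^ m) m λ (I : Subset N) →
    (γ * fromℚ (μ H m) ≤ fromℕ (#edgesIn H I))
    ⊎ (∃ λ (F : Subset N) → F ⊆ I × ∣ F ∣ ≡ ⌊εm⌋ ×
    ∃ λ (𝐅 : Vec (Subset N) (pred k)) →
    All (_⊆ F) 𝐅 × I ⊆ F ∪ proj₁ (f 𝐅)))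
theorem1p1 zero    ε B 0<ε 0<B = ⊥-elim (ℕ.≢-nonZero⁻¹ 0 refl)
theorem1p1 (suc j) ε B 0<ε 0<B =
  -- The constants come from `containers` applied to `1 / q`, which is at most `ε`, and to a natural
  -- number `b` that eventually bounds `B`.
  fromℚ (+ 1 ℚ./ g) , fromℕ t ,
  0<fromℚ (ℚ.positive⁻¹ _ {{ℚ.normalize-pos 1 g}}) , 0<fromℚ (ℚ.positive⁻¹ _ {{ι-positive 0<t}}) ,
  λ N H m₀ m₀<N Δ≤ m tm₀≤m m<N ⌊εm⌋ floor →
    let
      0<m₀ = ℕ.>-nonZero⁻¹ m₀
      tm₀≤m′ = ι-cancel (ℚ.≤-trans (ℚ.≤-reflexive (ι-* t m₀)) (fromℚ-cancel-≤ {ι t ℚ.* ι m₀} {ι m} tm₀≤m))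
      0<m  = ℕ.≤-trans (ℕ.*-mono-< 0<t 0<m₀) tm₀≤m′
      Δ≤b  = fromℚ-*-cancel-≤ {B} {b} {proj₁ (proj₂ (proj₂ (bounded-by-natural B)))} {Δ H m₀}
          {μ H m₀ ^ℚ 2 ℚ.* (+ 1 ℚ./ m₀)} B≤b (μ-square-nonNeg H m₀) Δ≤
      f , sparse , fingerprint = conclusion (edges H) (uniform H) m₀ m 0<m₀ tm₀≤m′ m<N
        (λ n r m₀≤n nr≤N → pairSum-≤ (suc j) n r m₀ m₀≤n nr≤N {+ m₀ ℚ./ N} (/-ι m₀ N) b (edges H) {+ 1 ℚ./ m₀}
            0<m₀ (uniform H) (/-ι 1 m₀) Δ≤b)
    in
    (λ 𝐅 → f 𝐅 , ≤-eventually (fromℕ (#edgesIn H (f 𝐅))) (ε * fromℕ (#edges H)) M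
        (λ i M≤i → ≤-scale 0<q (1≤qε i M≤i) (sparse 𝐅))) ,
    outcome H m f ⌊εm⌋ 0<m m<N floor fingerprint (⌊εm⌋ ℕ.≤? m)
  where
  q = proj₁ (reciprocal-≤ ε 0<ε)
  0<q = proj₁ (proj₂ (reciprocal-≤ ε 0<ε))
  M = proj₁ (proj₂ (proj₂ (reciprocal-≤ ε 0<ε)))
  1≤qε = proj₂ (proj₂ (proj₂ (reciprocal-≤ ε 0<ε)))
  b = proj₁ (bounded-by-natural B)
  0<b = proj₁ (proj₂ (bounded-by-natural B))
  B≤b = proj₂ (proj₂ (proj₂ (bounded-by-natural B)))
  g = proj₁ (containers j b q 0<b 0<q)
  t = proj₁ (proj₂ (containers j b q 0<b 0<q))
  0<g = proj₁ (proj₂ (proj₂ (containers j b q 0<b 0<q)))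
  0<t = proj₁ (proj₂ (proj₂ (proj₂ (containers j b q 0<b 0<q))))
  conclusion = proj₂ (proj₂ (proj₂ (proj₂ (containers j b q 0<b 0<q))))
  instance
    g≢0 : NonZero g
    g≢0 = ℕ.>-nonZero 0<g

  0≤ε : ∀ i → M ℕ.≤ i → 0ℚ ℚ.≤ seq ε i
  0≤ε i M≤i = ℚ.*-cancelˡ-≤-pos (ι q) {{ι-positive 0<q}}
    (ℚ.≤-trans (ℚ.≤-reflexive (ℚ.*-zeroʳ (ι q))) (ℚ.≤-trans (ℚ.nonNegative⁻¹ 1ℚ) (1≤qε i M≤i)))

  module _ {N : ℕ} .{{_ : NonZero N}} (H : Hypergraph (suc j) N) (m : ℕ) (f : Vec (Subset N) j → Subset N)
           (n : ℕ) (0<m : 0 ℕ.< m) (m<N : m ℕ.< N) (floor : IsFloor (ε * fromℕ m) n)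
           (fingerprint : ∀ I → #edgesIn H I ℕ.* (g ℕ.* N ℕ.^ suc j) ℕ.< #edges H ℕ.* m ℕ.^ suc j →
              ∃₂ λ F 𝐅 → F ⊆ I × q ℕ.* ∣ F ∣ ℕ.≤ m × All (_⊆ F) 𝐅 × I ⊆ F ∪ f 𝐅) where

    Outcome : Subset N → Set
    Outcome I = (fromℚ (+ 1 ℚ./ g) * fromℚ (μ H m) ≤ fromℕ (#edgesIn H I))
      ⊎ (∃ λ (F : Subset N) → F ⊆ I × ∣ F ∣ ≡ n ×
         ∃ λ (𝐅 : Vec (Subset N) j) → All (_⊆ F) 𝐅 × I ⊆ F ∪ f 𝐅)

    -- If ⌊εm⌋ > m, then ε ≥ 1 and the probability bound is trivial.
    outcome : Dec (n ℕ.≤ m) → WithProbabilityAtLeast (1ℝ - ε ^ m) m Outcome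
    outcome (no n≰m) = let M , 1≤ε = 1≤ε-eventually {ε} 0<m (ℕ.≰⇒> n≰m) floor in vacuously ε m 1≤ε
    outcome (yes n≤m) = surely ε m 0≤ε λ I ∣I∣≡m →
      by-count I ∣I∣≡m (#edges H ℕ.* m ℕ.^ suc j ℕ.≤? #edgesIn H I ℕ.* (g ℕ.* N ℕ.^ suc j))
      where
      by-count : ∀ I → ∣ I ∣ ≡ m → Dec (#edges H ℕ.* m ℕ.^ suc j ℕ.≤ #edgesIn H I ℕ.* (g ℕ.* N ℕ.^ suc j)) →
          Outcome I
      by-count I ∣I∣≡m (yes many) =
          inj₁ (≤-eventually (fromℚ (+ 1 ℚ./ g) * fromℚ (μ H m)) (fromℕ (#edgesIn H I)) 0 λ _ _ →
        edges-≤ (suc j) {N} {+ m ℚ./ N} {m} {+ 1 ℚ./ g} (#edges H) (#edgesIn H I) g (ℕ.>-nonZero⁻¹ N) 0<g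
            (/-ι m N) (/-ι 1 g) many)
      by-count I ∣I∣≡m (no few) =
        let F₀ , 𝐅 , F₀⊆I , qF₀≤m , 𝐅⊆F₀ , I⊆ = fingerprint I (ℕ.≰⇒> few)
            -- The fingerprint has at most `m / q` points and hence at most `n`. It can be padded
            -- inside `I` to exactly `n` because `n ≤ m = ∣ I ∣`.
            F , F₀⊆F , F⊆I , ∣F∣≡n = ⊆-between F₀ I n F₀⊆I (≤-floor {ε} 0<q 1≤qε qF₀≤m floor)
                (subst (n ℕ.≤_) (sym ∣I∣≡m) n≤m)
        in inj₂ (F , F⊆I , ∣F∣≡n , 𝐅 , All.map {P = _⊆ F₀} {Q = _⊆ F} (λ X⊆F₀ {x} x∈X → F₀⊆F (X⊆F₀ x∈X)) 𝐅⊆F₀ ,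
             λ v∈I → enlarge F₀ F (f 𝐅) F₀⊆F (I⊆ v∈I))
        where
        enlarge : ∀ (F₀ F S : Subset N) → F₀ ⊆ F → F₀ ∪ S ⊆ F ∪ S
        enlarge F₀ F S F₀⊆F v∈ with x∈p∪q⁻ F₀ S v∈
        ... | inj₁ v∈F₀ = x∈p∪q⁺ (inj₁ (F₀⊆F v∈F₀))
        ... | inj₂ v∈S  = x∈p∪q⁺ (inj₂ v∈S)
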